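{- Let $G=(V,D)$ be a simple directed graph. Then the transposed Jacobian $J(\psi_G)$ has full row rank $|D|+1$ over $\mathbb{R}(\lambda,s)$. Consequently every basis of the Jacobian matroid of $G$ has size $|D|+1$.
   Context: A directed graph $G=(V,D)$ has edge set $D\subseteq V\times V$ of ordered pairs $(i,j)$, $i\neq j$. It is simple if $(i,j)$ and $(j,i)$ are never both in $D$. Let $\Lambda$ be the $V\times V$ matrix with indeterminate entries $\lambda_{ij}$ for $(i,j)\in D$ and zeros elsewhere, and $s$ a further indeterminate. Let $\psi_G(\Lambda,s)=s(I-\Lambda)(I-\Lambda)^T=K$. The transposed Jacobian $J(\psi_G)$ is the $(|D|+1)\times\binom{|V|+1}{2}$ matrix with rows indexed by $\{\lambda_{kl}:(k,l)\in D\}\cup\{s\}$ and columns indexed by $K_{ij}$, $i\le j$, with entries $\partial K_{ij}/\partial\theta$. The Jacobian matroid of $G$ is the matroid on the columns in which a set is independent iff its columns are linearly independent over the rational function field $\mathbb{R}(\lambda,s)$. -}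

module Defs where

open import Level using (0ℓ)
open import Algebra.Bundles using (CommutativeRing; AbelianGroup)
import Algebra.Properties.Ring as RingProperties
import Algebra.Properties.Monoid.Sum as MonoidSum
import Algebra.Solver.Ring.NaturalCoefficients.Default as NatSolver
open import Data.Empty using (⊥-elim)
open import Data.Bool.Base using (if_then_else_)
open import Data.Nat.Base as ℕ using (ℕ; zero; suc; _⊔_)
import Data.Nat.Properties as ℕₚ
open import Data.Fin.Base using (Fin; zero; suc; inject₁; fromℕ)
import Data.Fin.Properties as Finₚ
open import Data.Fin.Subset using (Subset; _∉_; _⊆_; ∣_∣)
open import Data.List.Base using (List; []; _∷_; map; length; lookup; filter; cartesianProduct; allFin)
import Data.List.Membership.Propositional as List
open import Data.List.Relation.Unary.Any using (index)
open import Data.List.Relation.Unary.Unique.Propositional using (Unique)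
open import Data.Product.Base using (∃; _×_; _,_; proj₁; proj₂; uncurry)
open import Data.Product.Properties using (≡-dec)
open import Data.Sum.Base using (_⊎_; inj₁; inj₂; [_,_]′)
open import Data.Rational.Base as Rat using (ℚ; 0ℚ; 1ℚ; ½)
import Data.Rational.Properties as ℚₚ
open import Data.Rational.Solver using (module +-*-Solver)
open import Function.Base using (_$_)
open import Relation.Binary.Structures using (IsEquivalence)
open import Relation.Binary.PropositionalEquality as ≡ using (_≡_; _≢_; refl)
open import Relation.Nullary using (¬_; Dec; yes; no; does)

-- An integral domain, with the two classical principles about its equality
-- in the ¬¬-form in which they hold for the real numbers.

record IntegralDomain : Set₁ where
  field
    commutativeRing : CommutativeRing 0ℓ 0ℓ
  open CommutativeRing commutativeRing public
  field
    1≉0    : ¬ 1# ≈ 0#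
    stable : ∀ {x y} → ¬ ¬ x ≈ y → x ≈ y
    x*y≈0⇒¬¬x≈0∨y≈0 : ∀ {x y} → x * y ≈ 0# → ¬ ¬ (x ≈ 0# ⊎ y ≈ 0#)

  x*y≉0 : ∀ {x y} → ¬ x ≈ 0# → ¬ y ≈ 0# → ¬ x * y ≈ 0#
  x*y≉0 x≉0 y≉0 xy≈0 = x*y≈0⇒¬¬x≈0∨y≈0 xy≈0 [ x≉0 , y≉0 ]′

  *-cancelʳ-nonZero : ∀ {x y z} → ¬ z ≈ 0# → x * z ≈ y * z → x ≈ y
  *-cancelʳ-nonZero {x} {y} {z} z≉0 xz≈yz = stable λ x≉y →
    x*y≈0⇒¬¬x≈0∨y≈0 [x-y]z≈0 [ (λ e → x≉y (x-y≈0⇒x≈y e)) , z≉0 ]′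
    where
    open RingProperties ring using ([y-z]x≈yx-zx; x∙y⁻¹≈ε⇒x≈y)
    x-y≈0⇒x≈y : x - y ≈ 0# → x ≈ y
    x-y≈0⇒x≈y = x∙y⁻¹≈ε⇒x≈y x y
    [x-y]z≈0 : (x - y) * z ≈ 0#
    [x-y]z≈0 = trans ([y-z]x≈yx-zx z x y) (trans (+-congʳ xz≈yz) (-‿inverseʳ _))

-- ℝ: Cauchy sequences of rationals modulo null sequences

module Real where

  open import Data.Rational.Base using (_+_; _*_; -_; _-_; _<_; _≤_)
  open +-*-Solver using (solve; _:=_; _:+_; _:*_; _:-_; :-_; con)

  abs : ℚ → ℚ
  abs = Rat.∣_∣

  -- z m n tends to 0 as m and n both tend to ∞.
  Vanishes : (ℕ → ℕ → ℚ) → Set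
  Vanishes z = ∀ ε → 0ℚ < ε → ∃ λ N → ∀ m n → N ℕ.≤ m → N ℕ.≤ n → abs (z m n) < ε

  Null : (ℕ → ℚ) → Set
  Null z = Vanishes λ n _ → z n

  record ℝ : Set where
    constructor mkℝ
    field
      seq    : ℕ → ℚ
      cauchy : Vanishes λ m n → seq m - seq n
  open ℝ public

  infix 4 _≈_
  _≈_ : ℝ → ℝ → Set
  x ≈ y = Null λ n → seq x n - seq y n

  private
    Bounded : (ℕ → ℕ → ℚ) → Set
    Bounded w = ∃ λ B → 0ℚ < B × ∃ λ N → ∀ m n → N ℕ.≤ m → N ℕ.≤ n → abs (w m n) ≤ B

  private abstract
    0<½ε : ∀ {ε} → 0ℚ < ε → 0ℚ < ½ * ε
    0<½ε {ε} 0<ε = ℚₚ.positive⁻¹ (½ * ε) {{ℚₚ.pos*pos⇒pos ½ ε {{Rat.positive 0<ε}}}}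

    ½+½ : ∀ ε → ½ * ε + ½ * ε ≡ ε
    ½+½ = solve 1 (λ e → con ½ :* e :+ con ½ :* e := e) refl

    vanishes-≡ : ∀ {u v} → (∀ m n → u m n ≡ v m n) → Vanishes u → Vanishes v
    vanishes-≡ u≡v u→0 ε 0<ε with u→0 ε 0<ε
    ... | N , small = N , λ m n N≤m N≤n →
      ≡.subst (λ q → abs q < ε) (u≡v m n) (small m n N≤m N≤n)

    vanishes-0 : ∀ {u} → (∀ m n → u m n ≡ 0ℚ) → Vanishes u
    vanishes-0 u≡0 ε 0<ε = 0 , λ m n _ _ → ≡.subst (λ q → abs q < ε) (≡.sym (u≡0 m n)) 0<ε

    vanishes-+ : ∀ {u v} → Vanishes u → Vanishes v → Vanishes λ m n → u m n + v m n
    vanishes-+ {u} {v} u→0 v→0 ε 0<ε with u→0 (½ * ε) (0<½ε 0<ε) | v→0 (½ * ε) (0<½ε 0<ε)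
    ... | M , Mu | N , Nv = M ⊔ N , λ m n ≤m ≤n → begin-strict
      abs (u m n + v m n)       ≤⟨ ℚₚ.∣p+q∣≤∣p∣+∣q∣ (u m n) (v m n) ⟩
      abs (u m n) + abs (v m n) <⟨ ℚₚ.+-mono-<
        (Mu m n (ℕₚ.m⊔n≤o⇒m≤o M N ≤m) (ℕₚ.m⊔n≤o⇒m≤o M N ≤n))
        (Nv m n (ℕₚ.m⊔n≤o⇒n≤o M N ≤m) (ℕₚ.m⊔n≤o⇒n≤o M N ≤n)) ⟩
      ½ * ε + ½ * ε             ≡⟨ ½+½ ε ⟩
      ε                         ∎
      where open ℚₚ.≤-Reasoning

    vanishes-neg : ∀ {u} → Vanishes u → Vanishes λ m n → - u m n
    vanishes-neg {u} u→0 ε 0<ε with u→0 ε 0<ε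
    ... | N , small = N , λ m n N≤m N≤n →
      ≡.subst (_< ε) (≡.sym (ℚₚ.∣-p∣≡∣p∣ (u m n))) (small m n N≤m N≤n)

    vanishes-* : ∀ {w u} → Bounded w → Vanishes u → Vanishes λ m n → w m n * u m n
    vanishes-* {w} {u} (B , 0<B , M , w≤B) u→0 ε 0<ε = M ⊔ proj₁ u<δ , λ m n ≤m ≤n → begin-strict
      abs (w m n * u m n)       ≡⟨ ℚₚ.∣p*q∣≡∣p∣*∣q∣ (w m n) (u m n) ⟩
      abs (w m n) * abs (u m n) ≤⟨ ℚₚ.*-monoʳ-≤-nonNeg (abs (u m n)) {{ℚₚ.∣-∣-nonNeg (u m n)}}
        (w≤B m n (ℕₚ.m⊔n≤o⇒m≤o M _ ≤m) (ℕₚ.m⊔n≤o⇒m≤o M _ ≤n)) ⟩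
      B * abs (u m n)           <⟨ ℚₚ.*-monoʳ-<-pos B
        (proj₂ u<δ m n (ℕₚ.m⊔n≤o⇒n≤o M _ ≤m) (ℕₚ.m⊔n≤o⇒n≤o M _ ≤n)) ⟩
      B * δ                     ≡⟨ ℚₚ.*-assoc B (Rat.1/ B) ε ⟨
      B * (Rat.1/ B) * ε          ≡⟨ ≡.cong (_* ε) (ℚₚ.*-inverseʳ B) ⟩
      1ℚ * ε                    ≡⟨ ℚₚ.*-identityˡ ε ⟩
      ε                         ∎
      where
      open ℚₚ.≤-Reasoning
      instance
        B>0 : Rat.Positive B
        B>0 = Rat.positive 0<B
        B≢0 : Rat.NonZero B
        B≢0 = ℚₚ.pos⇒nonZero B
        ε>0 : Rat.Positive ε
        ε>0 = Rat.positive 0<ε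
        1/B>0 : Rat.Positive (Rat.1/ B)
        1/B>0 = ℚₚ.1/pos⇒pos B
      δ : ℚ
      δ = (Rat.1/ B) * ε
      u<δ : ∃ λ N → ∀ m n → N ℕ.≤ m → N ℕ.≤ n → abs (u m n) < δ
      u<δ = u→0 δ (ℚₚ.positive⁻¹ δ {{ℚₚ.pos*pos⇒pos (Rat.1/ B) ε}})

    0<1 : 0ℚ < 1ℚ
    0<1 = ℚₚ.positive⁻¹ 1ℚ

    bounded : (x : ℝ) → ∃ λ B → 0ℚ < B × ∃ λ N → ∀ n → N ℕ.≤ n → abs (seq x n) ≤ B
    bounded x with cauchy x 1ℚ 0<1
    ... | N , close = B , 0<B , N , λ n N≤n → begin
      abs (seq x n)                         ≡⟨ ≡.cong abs (split (seq x n) (seq x N)) ⟩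
      abs (seq x n - seq x N + seq x N)     ≤⟨ ℚₚ.∣p+q∣≤∣p∣+∣q∣ (seq x n - seq x N) (seq x N) ⟩
      abs (seq x n - seq x N) + abs (seq x N)
        ≤⟨ ℚₚ.+-monoˡ-≤ (abs (seq x N)) (ℚₚ.<⇒≤ (close n N N≤n ℕₚ.≤-refl)) ⟩
      B                                     ∎
      where
      open ℚₚ.≤-Reasoning
      B : ℚ
      B = 1ℚ + abs (seq x N)
      0<B : 0ℚ < B
      0<B = ℚₚ.+-mono-<-≤ 0<1 (ℚₚ.0≤∣p∣ (seq x N))
      split : ∀ a b → a ≡ a - b + b
      split = solve 2 (λ a b → a := a :- b :+ b) refl

    bounded₁ : (x : ℝ) → Bounded λ m _ → seq x m
    bounded₁ x = let B , 0<B , N , b = bounded x in B , 0<B , N , λ m _ N≤m _ → b m N≤m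

    bounded₂ : (x : ℝ) → Bounded λ _ n → seq x n
    bounded₂ x = let B , 0<B , N , b = bounded x in B , 0<B , N , λ _ n _ N≤n → b n N≤n

    xy-x′y′ : ∀ x y x′ y′ → x * (y - y′) + y′ * (x - x′) ≡ x * y - x′ * y′
    xy-x′y′ = solve 4 (λ x y x′ y′ → x :* (y :- y′) :+ y′ :* (x :- x′) := x :* y :- x′ :* y′) refl

  fromℚ : ℚ → ℝ
  fromℚ q = mkℝ (λ _ → q) (vanishes-0 λ _ _ → ℚₚ.+-inverseʳ q)

  infixl 6 _⊕_
  infixl 7 _⊗_

  _⊕_ : ℝ → ℝ → ℝ
  x ⊕ y = mkℝ (λ n → seq x n + seq y n) $
    vanishes-≡ (λ m n → eq (seq x m) (seq x n) (seq y m) (seq y n)) (vanishes-+ (cauchy x) (cauchy y))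
    where
    eq : ∀ a a′ b b′ → (a - a′) + (b - b′) ≡ (a + b) - (a′ + b′)
    eq = solve 4 (λ a a′ b b′ → (a :- a′) :+ (b :- b′) := (a :+ b) :- (a′ :+ b′)) refl

  _⊗_ : ℝ → ℝ → ℝ
  x ⊗ y = mkℝ (λ n → seq x n * seq y n) $
    vanishes-≡ (λ m n → xy-x′y′ (seq x m) (seq y m) (seq x n) (seq y n)) $
    vanishes-+ (vanishes-* (bounded₁ x) (cauchy y)) (vanishes-* (bounded₂ y) (cauchy x))

  ⊖_ : ℝ → ℝ
  ⊖ x = mkℝ (λ n → - seq x n) $
    vanishes-≡ (λ m n → eq (seq x m) (seq x n)) (vanishes-neg (cauchy x))
    where
    eq : ∀ a b → - (a - b) ≡ - a - - b
    eq = solve 2 (λ a b → :- (a :- b) := :- a :- :- b) refl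

  private
    pointwise : ∀ {x y} → (∀ n → seq x n ≡ seq y n) → x ≈ y
    pointwise {x} {y} eq = vanishes-0 λ n _ →
      ≡.trans (≡.cong (_- seq y n) (eq n)) (ℚₚ.+-inverseʳ (seq y n))

    ≈-isEquivalence : IsEquivalence _≈_
    ≈-isEquivalence = record
      { refl  = λ {x} → pointwise {x} {x} λ _ → refl
      ; sym   = λ {x} {y} x≈y →
          vanishes-≡ (λ n _ → symEq (seq x n) (seq y n)) (vanishes-neg x≈y)
      ; trans = λ {x} {y} {z} x≈y y≈z →
          vanishes-≡ (λ n _ → transEq (seq x n) (seq y n) (seq z n)) (vanishes-+ x≈y y≈z)
      }
      where
      symEq : ∀ a b → - (a - b) ≡ b - a
      symEq = solve 2 (λ a b → :- (a :- b) := b :- a) refl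
      transEq : ∀ a b c → (a - b) + (b - c) ≡ a - c
      transEq = solve 3 (λ a b c → (a :- b) :+ (b :- c) := a :- c) refl

    ⊕-cong : ∀ {x x′ y y′} → x ≈ x′ → y ≈ y′ → x ⊕ y ≈ x′ ⊕ y′
    ⊕-cong {x} {x′} {y} {y′} p q =
      vanishes-≡ (λ n _ → eq (seq x n) (seq x′ n) (seq y n) (seq y′ n)) (vanishes-+ p q)
      where
      eq : ∀ a a′ b b′ → (a - a′) + (b - b′) ≡ (a + b) - (a′ + b′)
      eq = solve 4 (λ a a′ b b′ → (a :- a′) :+ (b :- b′) := (a :+ b) :- (a′ :+ b′)) refl

    ⊗-cong : ∀ {x x′ y y′} → x ≈ x′ → y ≈ y′ → x ⊗ y ≈ x′ ⊗ y′
    ⊗-cong {x} {x′} {y} {y′} p q =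
      vanishes-≡ (λ n _ → xy-x′y′ (seq x n) (seq y n) (seq x′ n) (seq y′ n)) $
      vanishes-+ (vanishes-* (bounded₁ x) q) (vanishes-* (bounded₁ y′) p)

    ⊖-cong : ∀ {x x′} → x ≈ x′ → ⊖ x ≈ ⊖ x′
    ⊖-cong {x} {x′} p = vanishes-≡ (λ n _ → eq (seq x n) (seq x′ n)) (vanishes-neg p)
      where
      eq : ∀ a b → - (a - b) ≡ - a - - b
      eq = solve 2 (λ a b → :- (a :- b) := :- a :- :- b) refl

  ℝ-commutativeRing : CommutativeRing 0ℓ 0ℓ
  ℝ-commutativeRing = record
    { Carrier = ℝ
    ; _≈_     = _≈_
    ; _+_     = _⊕_
    ; _*_     = _⊗_
    ; -_      = ⊖_
    ; 0#      = fromℚ 0ℚ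
    ; 1#      = fromℚ 1ℚ
    ; isCommutativeRing = record
      { isRing = record
        { +-isAbelianGroup = record
          { isGroup = record
            { isMonoid = record
              { isSemigroup = record
                { isMagma = record
                  { isEquivalence = ≈-isEquivalence
                  ; ∙-cong        = λ {x} {x′} {y} {y′} → ⊕-cong {x} {x′} {y} {y′}
                  }
                ; assoc = λ x y z → pointwise {x ⊕ y ⊕ z} {x ⊕ (y ⊕ z)}
                    λ n → ℚₚ.+-assoc (seq x n) (seq y n) (seq z n)
                }
              ; identity = (λ x → pointwise {fromℚ 0ℚ ⊕ x} {x} λ n → ℚₚ.+-identityˡ (seq x n))
                         , (λ x → pointwise {x ⊕ fromℚ 0ℚ} {x} λ n → ℚₚ.+-identityʳ (seq x n))
              }
            ; inverse = (λ x → pointwise {⊖ x ⊕ x} {fromℚ 0ℚ} λ n → ℚₚ.+-inverseˡ (seq x n))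
                      , (λ x → pointwise {x ⊕ ⊖ x} {fromℚ 0ℚ} λ n → ℚₚ.+-inverseʳ (seq x n))
            ; ⁻¹-cong = λ {x} {x′} → ⊖-cong {x} {x′}
            }
          ; comm = λ x y → pointwise {x ⊕ y} {y ⊕ x} λ n → ℚₚ.+-comm (seq x n) (seq y n)
          }
        ; *-cong     = λ {x} {x′} {y} {y′} → ⊗-cong {x} {x′} {y} {y′}
        ; *-assoc    = λ x y z → pointwise {x ⊗ y ⊗ z} {x ⊗ (y ⊗ z)}
            λ n → ℚₚ.*-assoc (seq x n) (seq y n) (seq z n)
        ; *-identity = (λ x → pointwise {fromℚ 1ℚ ⊗ x} {x} λ n → ℚₚ.*-identityˡ (seq x n))
                     , (λ x → pointwise {x ⊗ fromℚ 1ℚ} {x} λ n → ℚₚ.*-identityʳ (seq x n))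
        ; distrib    = (λ x y z → pointwise {x ⊗ (y ⊕ z)} {x ⊗ y ⊕ x ⊗ z}
                          λ n → ℚₚ.*-distribˡ-+ (seq x n) (seq y n) (seq z n))
                     , (λ x y z → pointwise {(y ⊕ z) ⊗ x} {y ⊗ x ⊕ z ⊗ x}
                          λ n → ℚₚ.*-distribʳ-+ (seq x n) (seq y n) (seq z n))
        }
      ; *-comm = λ x y → pointwise {x ⊗ y} {y ⊗ x} λ n → ℚₚ.*-comm (seq x n) (seq y n)
      }
    }

  private
    AwayFrom0 : (ℕ → ℚ) → Set
    AwayFrom0 z = ∃ λ δ → 0ℚ < δ × ∃ λ N → ∀ n → N ℕ.≤ n → δ ≤ abs (z n)

    null⇒¬away : ∀ {z} → Null z → ¬ AwayFrom0 z
    null⇒¬away z→0 (δ , 0<δ , M , away) with z→0 δ 0<δ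
    ... | N , small = ℚₚ.<-irrefl refl $ ℚₚ.<-≤-trans
      (small (M ⊔ N) (M ⊔ N) (ℕₚ.m≤n⊔m M N) (ℕₚ.m≤n⊔m M N)) (away (M ⊔ N) (ℕₚ.m≤m⊔n M N))

    ¬away⇒null : (x : ℝ) → ¬ AwayFrom0 (seq x) → Null (seq x)
    ¬away⇒null x ¬away ε 0<ε with cauchy x q (0<½ε (0<½ε 0<ε))
      where
      q : ℚ
      q = ½ * (½ * ε)
    ... | N , close with abs (seq x N) ℚₚ.<? ½ * ε
    ...   | yes small = N , λ n _ N≤n _ → begin-strict
      abs (seq x n)                               ≡⟨ ≡.cong abs (split (seq x n) (seq x N)) ⟩
      abs (seq x n - seq x N + seq x N)           ≤⟨ ℚₚ.∣p+q∣≤∣p∣+∣q∣ (seq x n - seq x N) (seq x N) ⟩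
      abs (seq x n - seq x N) + abs (seq x N)     <⟨ ℚₚ.+-mono-< (close n N N≤n ℕₚ.≤-refl) small ⟩
      ½ * (½ * ε) + ½ * ε                         ≤⟨ ℚₚ.+-monoˡ-≤ (½ * ε) ¼≤½ ⟩
      ½ * ε + ½ * ε                               ≡⟨ ½+½ ε ⟩
      ε                                           ∎
      where
      open ℚₚ.≤-Reasoning
      split : ∀ a b → a ≡ a - b + b
      split = solve 2 (λ a b → a := a :- b :+ b) refl
      ¼≤½ : ½ * (½ * ε) ≤ ½ * ε
      ¼≤½ = begin
        ½ * (½ * ε)               ≡⟨ ℚₚ.+-identityʳ _ ⟨
        ½ * (½ * ε) + 0ℚ          ≤⟨ ℚₚ.+-monoʳ-≤ (½ * (½ * ε)) (ℚₚ.<⇒≤ (0<½ε (0<½ε 0<ε))) ⟩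
        ½ * (½ * ε) + ½ * (½ * ε) ≡⟨ ½+½ (½ * ε) ⟩
        ½ * ε                     ∎
    ...   | no large = ⊥-elim $ ¬away $ q , 0<½ε (0<½ε 0<ε) , N , λ n N≤n →
      ℚₚ.≮⇒≥ λ xn<q → large $ begin-strict
        abs (seq x N)                           ≡⟨ ≡.cong abs (split (seq x N) (seq x n)) ⟩
        abs (seq x N - seq x n + seq x n)       ≤⟨ ℚₚ.∣p+q∣≤∣p∣+∣q∣ (seq x N - seq x n) (seq x n) ⟩
        abs (seq x N - seq x n) + abs (seq x n) <⟨ ℚₚ.+-mono-< (close N n ℕₚ.≤-refl N≤n) xn<q ⟩
        q + q                                   ≡⟨ ½+½ (½ * ε) ⟩
        ½ * ε                                   ∎
      where
      open ℚₚ.≤-Reasoning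
      q : ℚ
      q = ½ * (½ * ε)
      split : ∀ a b → a ≡ a - b + b
      split = solve 2 (λ a b → a := a :- b :+ b) refl

    away-* : ∀ {u v} → AwayFrom0 u → AwayFrom0 v → AwayFrom0 λ n → u n * v n
    away-* {u} {v} (γ , 0<γ , M , γ≤u) (δ , 0<δ , N , δ≤v) =
      γ * δ , ℚₚ.positive⁻¹ (γ * δ) {{ℚₚ.pos*pos⇒pos γ δ}} , M ⊔ N , λ n ≤n → begin
        γ * δ               ≤⟨ ℚₚ.*-monoʳ-≤-nonNeg δ {{ℚₚ.pos⇒nonNeg δ}} (γ≤u n (ℕₚ.m⊔n≤o⇒m≤o M N ≤n)) ⟩
        abs (u n) * δ       ≤⟨ ℚₚ.*-monoˡ-≤-nonNeg (abs (u n)) {{ℚₚ.∣-∣-nonNeg (u n)}} (δ≤v n (ℕₚ.m⊔n≤o⇒n≤o M N ≤n)) ⟩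
        abs (u n) * abs (v n) ≡⟨ ℚₚ.∣p*q∣≡∣p∣*∣q∣ (u n) (v n) ⟨
        abs (u n * v n)     ∎
      where
      open ℚₚ.≤-Reasoning
      instance
        γ>0 : Rat.Positive γ
        γ>0 = Rat.positive 0<γ
        δ>0 : Rat.Positive δ
        δ>0 = Rat.positive 0<δ

    a-0≡a : ∀ a → a - 0ℚ ≡ a
    a-0≡a = solve 1 (λ a → a :- con 0ℚ := a) refl

    ≈0⇒null : ∀ x → x ≈ fromℚ 0ℚ → Null (seq x)
    ≈0⇒null x = vanishes-≡ λ n _ → a-0≡a (seq x n)

    null⇒≈0 : ∀ x → Null (seq x) → x ≈ fromℚ 0ℚ
    null⇒≈0 x = vanishes-≡ λ n _ → ≡.sym (a-0≡a (seq x n))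

  ℝ-integralDomain : IntegralDomain
  ℝ-integralDomain = record
    { commutativeRing = ℝ-commutativeRing
    ; 1≉0 = λ 1≈0 → null⇒¬away {λ _ → 1ℚ} (≈0⇒null (fromℚ 1ℚ) 1≈0) (1ℚ , 0<1 , 0 , λ _ _ → ℚₚ.≤-refl)
    ; stable = λ {x} {y} ¬x≉y → ¬away⇒null (x ⊕ ⊖ y) λ away → ¬x≉y λ x≈y → null⇒¬away {λ n → seq x n - seq y n} x≈y away
    ; x*y≈0⇒¬¬x≈0∨y≈0 = λ {x} {y} xy≈0 neither →
        neither $ inj₁ $ null⇒≈0 x $ ¬away⇒null x λ xAway →
        neither $ inj₂ $ null⇒≈0 y $ ¬away⇒null y λ yAway →
        null⇒¬away {seq (x ⊗ y)} (≈0⇒null (x ⊗ y) xy≈0)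
          (away-* {seq x} {seq y} xAway yAway)
    }

open Real public using (ℝ; ℝ-commutativeRing; ℝ-integralDomain)

-- R[X]: lists of coefficients, constant term first, trailing zeros allowed

module Polynomial (R : CommutativeRing 0ℓ 0ℓ) where

  open CommutativeRing R
  open RingProperties ring using (-0#≈0#)
  import Relation.Binary.Reasoning.Setoid as SetoidReasoning

  Poly : Set
  Poly = List Carrier

  coeff : Poly → ℕ → Carrier
  coeff []      _       = 0#
  coeff (a ∷ _) zero    = a
  coeff (_ ∷ p) (suc i) = coeff p i

  infix 4 _≋_
  record _≋_ (p q : Poly) : Set where
    constructor coeffwise
    field at : ∀ i → coeff p i ≈ coeff q i
  open _≋_ public

  infixl 6 _⊕_
  infixl 7 _⊗_
  infixr 7 _·_

  _⊕_ : Poly → Poly → Poly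
  []      ⊕ q       = q
  (a ∷ p) ⊕ []      = a ∷ p
  (a ∷ p) ⊕ (b ∷ q) = (a + b) ∷ (p ⊕ q)

  ⊖_ : Poly → Poly
  ⊖_ = map (-_)

  _·_ : Carrier → Poly → Poly
  c · p = map (c *_) p

  X·_ : Poly → Poly
  X· p = 0# ∷ p

  _⊗_ : Poly → Poly → Poly
  []      ⊗ q = []
  (a ∷ p) ⊗ q = a · q ⊕ X· (p ⊗ q)

  const : Carrier → Poly
  const a = a ∷ []

  X : Poly
  X = X· const 1#

  -- (a + X p)′ = p + X p′
  derivative : Poly → Poly
  derivative []      = []
  derivative (a ∷ p) = p ⊕ X· (derivative p)

  coeff-⊕ : ∀ p q i → coeff (p ⊕ q) i ≈ coeff p i + coeff q i
  coeff-⊕ []      q       i       = sym (+-identityˡ _)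
  coeff-⊕ (a ∷ p) []      i       = sym (+-identityʳ _)
  coeff-⊕ (a ∷ p) (b ∷ q) zero    = CommutativeRing.refl R
  coeff-⊕ (a ∷ p) (b ∷ q) (suc i) = coeff-⊕ p q i

  coeff-⊖ : ∀ p i → coeff (⊖ p) i ≈ - coeff p i
  coeff-⊖ []      i       = sym -0#≈0#
  coeff-⊖ (a ∷ p) zero    = CommutativeRing.refl R
  coeff-⊖ (a ∷ p) (suc i) = coeff-⊖ p i

  coeff-· : ∀ c p i → coeff (c · p) i ≈ c * coeff p i
  coeff-· c []      i       = sym (zeroʳ c)
  coeff-· c (a ∷ p) zero    = CommutativeRing.refl R
  coeff-· c (a ∷ p) (suc i) = coeff-· c p i

  +-abelianGroup′ : AbelianGroup 0ℓ 0ℓ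
  +-abelianGroup′ = record
    { Carrier = Poly
    ; _≈_     = _≋_
    ; _∙_     = _⊕_
    ; ε       = []
    ; _⁻¹     = ⊖_
    ; isAbelianGroup = record
      { isGroup = record
        { isMonoid = record
          { isSemigroup = record
            { isMagma = record
              { isEquivalence = record
                { refl  = coeffwise λ i → CommutativeRing.refl R
                ; sym   = λ e → coeffwise λ i → sym (at e i)
                ; trans = λ e f → coeffwise λ i → trans (at e i) (at f i)
                }
              ; ∙-cong = λ {p} {p′} {q} {q′} e f → coeffwise λ i → begin
                  coeff (p ⊕ q) i         ≈⟨ coeff-⊕ p q i ⟩
                  coeff p i + coeff q i   ≈⟨ +-cong (at e i) (at f i) ⟩
                  coeff p′ i + coeff q′ i ≈⟨ coeff-⊕ p′ q′ i ⟨
                  coeff (p′ ⊕ q′) i       ∎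
              }
            ; assoc = λ p q r → coeffwise λ i → begin
                coeff (p ⊕ q ⊕ r) i                   ≈⟨ coeff-⊕ (p ⊕ q) r i ⟩
                coeff (p ⊕ q) i + coeff r i           ≈⟨ +-congʳ (coeff-⊕ p q i) ⟩
                coeff p i + coeff q i + coeff r i     ≈⟨ +-assoc _ _ _ ⟩
                coeff p i + (coeff q i + coeff r i)   ≈⟨ +-congˡ (coeff-⊕ q r i) ⟨
                coeff p i + coeff (q ⊕ r) i           ≈⟨ coeff-⊕ p (q ⊕ r) i ⟨
                coeff (p ⊕ (q ⊕ r)) i                 ∎
            }
          ; identity = (λ p → coeffwise λ i → CommutativeRing.refl R)
                     , (λ p → coeffwise λ i → trans (coeff-⊕ p [] i) (+-identityʳ _))
          }
        ; inverse = (λ p → coeffwise λ i → begin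
                      coeff (⊖ p ⊕ p) i         ≈⟨ coeff-⊕ (⊖ p) p i ⟩
                      coeff (⊖ p) i + coeff p i ≈⟨ +-congʳ (coeff-⊖ p i) ⟩
                      - coeff p i + coeff p i   ≈⟨ -‿inverseˡ _ ⟩
                      0#                        ∎)
                  , (λ p → coeffwise λ i → begin
                      coeff (p ⊕ ⊖ p) i         ≈⟨ coeff-⊕ p (⊖ p) i ⟩
                      coeff p i + coeff (⊖ p) i ≈⟨ +-congˡ (coeff-⊖ p i) ⟩
                      coeff p i - coeff p i     ≈⟨ -‿inverseʳ _ ⟩
                      0#                        ∎)
        ; ⁻¹-cong = λ {p} {q} e → coeffwise λ i → begin
            coeff (⊖ p) i ≈⟨ coeff-⊖ p i ⟩
            - coeff p i   ≈⟨ -‿cong (at e i) ⟩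
            - coeff q i   ≈⟨ coeff-⊖ q i ⟨
            coeff (⊖ q) i ∎
        }
      ; comm = λ p q → coeffwise λ i → begin
          coeff (p ⊕ q) i       ≈⟨ coeff-⊕ p q i ⟩
          coeff p i + coeff q i ≈⟨ +-comm _ _ ⟩
          coeff q i + coeff p i ≈⟨ coeff-⊕ q p i ⟨
          coeff (q ⊕ p) i       ∎
      }
    }
    where open SetoidReasoning setoid

  private module P where
    open AbelianGroup +-abelianGroup′ public
    open import Algebra.Properties.CommutativeSemigroup commutativeSemigroup public
      using (interchange; x∙yz≈y∙xz)

  ∷-cong : ∀ {a b p q} → a ≈ b → p ≋ q → a ∷ p ≋ b ∷ q
  ∷-cong a≈b p≋q = coeffwise λ { zero → a≈b ; (suc i) → at p≋q i }

  X·-cong : ∀ {p q} → p ≋ q → X· p ≋ X· q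
  X·-cong = ∷-cong (CommutativeRing.refl R)

  X·-[] : X· [] ≋ []
  X·-[] = coeffwise λ { zero → CommutativeRing.refl R ; (suc i) → CommutativeRing.refl R }

  X·-⊕ : ∀ p q → X· (p ⊕ q) ≋ X· p ⊕ X· q
  X·-⊕ p q = ∷-cong (sym (+-identityˡ 0#)) P.refl

  ·-cong : ∀ {a b p q} → a ≈ b → p ≋ q → a · p ≋ b · q
  ·-cong {a} {b} {p} {q} a≈b p≋q = coeffwise λ i →
    trans (coeff-· a p i) (trans (*-cong a≈b (at p≋q i)) (sym (coeff-· b q i)))

  ·-⊕ : ∀ c p q → c · (p ⊕ q) ≋ c · p ⊕ c · q
  ·-⊕ c []      q       = P.refl
  ·-⊕ c (a ∷ p) []      = P.refl
  ·-⊕ c (a ∷ p) (b ∷ q) = ∷-cong (distribˡ c a b) (·-⊕ c p q)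

  ·-* : ∀ a b p → (a * b) · p ≋ a · b · p
  ·-* a b []      = P.refl
  ·-* a b (c ∷ p) = ∷-cong (*-assoc a b c) (·-* a b p)

  ·-X· : ∀ c p → c · X· p ≋ X· (c · p)
  ·-X· c p = ∷-cong (zeroʳ c) P.refl

  0#· : ∀ p → 0# · p ≋ []
  0#· p = coeffwise λ i → trans (coeff-· 0# p i) (zeroˡ _)

  1#· : ∀ p → 1# · p ≋ p
  1#· p = coeffwise λ i → trans (coeff-· 1# p i) (*-identityˡ _)

  open SetoidReasoning P.setoid

  ⊗-congˡ : ∀ p {q r} → q ≋ r → p ⊗ q ≋ p ⊗ r
  ⊗-congˡ []      q≋r = P.refl
  ⊗-congˡ (a ∷ p) q≋r =
    P.∙-cong (·-cong (CommutativeRing.refl R) q≋r) (X·-cong (⊗-congˡ p q≋r))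

  ⊗-zeroʳ : ∀ p → p ⊗ [] ≋ []
  ⊗-zeroʳ []      = P.refl
  ⊗-zeroʳ (a ∷ p) = P.trans (X·-cong (⊗-zeroʳ p)) X·-[]

  ⊗-∷ : ∀ p b q → p ⊗ (b ∷ q) ≋ b · p ⊕ X· (p ⊗ q)
  ⊗-∷ []      b q = P.sym X·-[]
  ⊗-∷ (a ∷ p) b q = ∷-cong (+-congʳ (*-comm a b)) $ begin
    a · q ⊕ p ⊗ (b ∷ q)           ≈⟨ P.∙-congˡ {a · q} (⊗-∷ p b q) ⟩
    a · q ⊕ (b · p ⊕ X· (p ⊗ q))  ≈⟨ P.x∙yz≈y∙xz (a · q) (b · p) _ ⟩
    b · p ⊕ (a · q ⊕ X· (p ⊗ q))  ∎

  ⊗-comm : ∀ p q → p ⊗ q ≋ q ⊗ p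
  ⊗-comm []      q = P.sym (⊗-zeroʳ q)
  ⊗-comm (a ∷ p) q = begin
    a · q ⊕ X· (p ⊗ q) ≈⟨ P.∙-congˡ {a · q} (X·-cong (⊗-comm p q)) ⟩
    a · q ⊕ X· (q ⊗ p) ≈⟨ ⊗-∷ q a p ⟨
    q ⊗ (a ∷ p)        ∎

  ⊗-cong : ∀ {p p′ q q′} → p ≋ p′ → q ≋ q′ → p ⊗ q ≋ p′ ⊗ q′
  ⊗-cong {p} {p′} {q} {q′} e f = begin
    p ⊗ q   ≈⟨ ⊗-congˡ p f ⟩
    p ⊗ q′  ≈⟨ ⊗-comm p q′ ⟩
    q′ ⊗ p  ≈⟨ ⊗-congˡ q′ e ⟩
    q′ ⊗ p′ ≈⟨ ⊗-comm q′ p′ ⟩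
    p′ ⊗ q′ ∎

  ⊗-distribˡ : ∀ p q r → p ⊗ (q ⊕ r) ≋ p ⊗ q ⊕ p ⊗ r
  ⊗-distribˡ []      q r = P.refl
  ⊗-distribˡ (a ∷ p) q r = begin
    a · (q ⊕ r) ⊕ X· (p ⊗ (q ⊕ r))
      ≈⟨ P.∙-cong (·-⊕ a q r) (P.trans (X·-cong (⊗-distribˡ p q r)) (X·-⊕ (p ⊗ q) (p ⊗ r))) ⟩
    (a · q ⊕ a · r) ⊕ (X· (p ⊗ q) ⊕ X· (p ⊗ r))
      ≈⟨ P.interchange (a · q) (a · r) (X· (p ⊗ q)) (X· (p ⊗ r)) ⟩
    (a · q ⊕ X· (p ⊗ q)) ⊕ (a · r ⊕ X· (p ⊗ r)) ∎

  ⊗-distribʳ : ∀ r p q → (p ⊕ q) ⊗ r ≋ p ⊗ r ⊕ q ⊗ r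
  ⊗-distribʳ r p q = begin
    (p ⊕ q) ⊗ r   ≈⟨ ⊗-comm (p ⊕ q) r ⟩
    r ⊗ (p ⊕ q)   ≈⟨ ⊗-distribˡ r p q ⟩
    r ⊗ p ⊕ r ⊗ q ≈⟨ P.∙-cong (⊗-comm r p) (⊗-comm r q) ⟩
    p ⊗ r ⊕ q ⊗ r ∎

  ·-⊗ : ∀ a q r → (a · q) ⊗ r ≋ a · (q ⊗ r)
  ·-⊗ a []      r = P.refl
  ·-⊗ a (b ∷ q) r = begin
    (a * b) · r ⊕ X· ((a · q) ⊗ r) ≈⟨ P.∙-cong (·-* a b r) (X·-cong (·-⊗ a q r)) ⟩
    a · b · r ⊕ X· (a · (q ⊗ r))   ≈⟨ P.∙-congˡ {a · b · r} (·-X· a (q ⊗ r)) ⟨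
    a · b · r ⊕ a · X· (q ⊗ r)     ≈⟨ ·-⊕ a (b · r) (X· (q ⊗ r)) ⟨
    a · (b · r ⊕ X· (q ⊗ r))       ∎

  ⊗-assoc : ∀ p q r → (p ⊗ q) ⊗ r ≋ p ⊗ (q ⊗ r)
  ⊗-assoc []      q r = P.refl
  ⊗-assoc (a ∷ p) q r = begin
    (a · q ⊕ X· (p ⊗ q)) ⊗ r         ≈⟨ ⊗-distribʳ r (a · q) (X· (p ⊗ q)) ⟩
    (a · q) ⊗ r ⊕ X· (p ⊗ q) ⊗ r     ≈⟨ P.∙-cong (·-⊗ a q r) (P.∙-congʳ (0#· r)) ⟩
    a · (q ⊗ r) ⊕ X· ((p ⊗ q) ⊗ r)   ≈⟨ P.∙-congˡ {a · (q ⊗ r)} (X·-cong (⊗-assoc p q r)) ⟩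
    a · (q ⊗ r) ⊕ X· (p ⊗ (q ⊗ r))   ∎

  ⊗-identityˡ : ∀ p → const 1# ⊗ p ≋ p
  ⊗-identityˡ p = begin
    1# · p ⊕ X· [] ≈⟨ P.∙-cong (1#· p) X·-[] ⟩
    p ⊕ []         ≈⟨ P.identityʳ p ⟩
    p              ∎

  poly-commutativeRing : CommutativeRing 0ℓ 0ℓ
  poly-commutativeRing = record
    { Carrier = Poly
    ; _≈_     = _≋_
    ; _+_     = _⊕_
    ; _*_     = _⊗_
    ; -_      = ⊖_
    ; 0#      = []
    ; 1#      = const 1#
    ; isCommutativeRing = record
      { isRing = record
        { +-isAbelianGroup = P.isAbelianGroup
        ; *-cong           = ⊗-cong
        ; *-assoc          = ⊗-assoc
        ; *-identity       = ⊗-identityˡ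
                           , (λ p → P.trans (⊗-comm p (const 1#)) (⊗-identityˡ p))
        ; distrib          = ⊗-distribˡ , ⊗-distribʳ
        }
      ; *-comm = ⊗-comm
      }
    }

open Polynomial using (coeffwise; at)

poly-integralDomain : IntegralDomain → IntegralDomain
poly-integralDomain R = record
  { commutativeRing = poly-commutativeRing
  ; 1≉0    = λ 1≋0 → 1≉0 (at 1≋0 0)
  ; stable = λ ¬p≉q → coeffwise λ i → stable λ pᵢ≉qᵢ → ¬p≉q λ p≋q → pᵢ≉qᵢ (at p≋q i)
  ; x*y≈0⇒¬¬x≈0∨y≈0 = λ {p} {q} → zeroDivisors p q
  }
  where
  open IntegralDomain R hiding (commutativeRing)
  open Polynomial (IntegralDomain.commutativeRing R) hiding (coeffwise; at)
  module P = CommutativeRing poly-commutativeRing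

  ∷≋0 : ∀ {a p} → a ≈ 0# → p ≋ [] → a ∷ p ≋ []
  ∷≋0 a≈0 p≋0 = coeffwise λ { zero → a≈0 ; (suc i) → at p≋0 i }

  -- If a ≈ 0 then (a + X p) q ≈ X p q.
  tail-⊗ : ∀ {a} p q → a ≈ 0# → (a ∷ p) ⊗ q ≋ [] → p ⊗ q ≋ []
  tail-⊗ {a} p q a≈0 apq≋0 = coeffwise λ i → begin
    coeff (p ⊗ q) i                           ≈⟨ +-identityˡ _ ⟨
    0# + coeff (p ⊗ q) i                      ≈⟨ +-congʳ (zeroˡ _) ⟨
    0# * coeff q (suc i) + coeff (p ⊗ q) i    ≈⟨ +-congʳ (*-congʳ a≈0) ⟨
    a * coeff q (suc i) + coeff (p ⊗ q) i     ≈⟨ +-congʳ (coeff-· a q (suc i)) ⟨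
    coeff (a · q) (suc i) + coeff (p ⊗ q) i   ≈⟨ coeff-⊕ (a · q) (X· (p ⊗ q)) (suc i) ⟨
    coeff ((a ∷ p) ⊗ q) (suc i)               ≈⟨ at apq≋0 (suc i) ⟩
    0#                                        ∎
    where open import Relation.Binary.Reasoning.Setoid setoid

  zeroDivisors : ∀ p q → p ⊗ q ≋ [] → ¬ ¬ (p ≋ [] ⊎ q ≋ [])
  zeroDivisors []      q       pq≋0 k = k (inj₁ P.refl)
  zeroDivisors (a ∷ p) []      pq≋0 k = k (inj₂ P.refl)
  zeroDivisors (a ∷ p) (b ∷ q) pq≋0 k =
    x*y≈0⇒¬¬x≈0∨y≈0 (trans (sym (+-identityʳ (a * b))) (at pq≋0 0))
    [ (λ a≈0 → zeroDivisors p (b ∷ q) (tail-⊗ p (b ∷ q) a≈0 pq≋0)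
        [ (λ p≋0 → k (inj₁ (∷≋0 a≈0 p≋0))) , (λ q≋0 → k (inj₂ q≋0)) ]′)
    , (λ b≈0 → zeroDivisors (a ∷ p) q
          (P.trans (P.*-comm (a ∷ p) q)
            (tail-⊗ q (a ∷ p) b≈0 (P.trans (P.*-comm (b ∷ q) (a ∷ p)) pq≋0)))
        [ (λ p≋0 → k (inj₁ p≋0)) , (λ q≋0 → k (inj₂ (∷≋0 b≈0 q≋0))) ]′)
    ]′

-- ℝ[x₀,…,xₙ₋₁] = ℝ[x₁,…,xₙ₋₁][x₀]

ℝ[_] : ℕ → IntegralDomain
ℝ[ zero ]  = ℝ-integralDomain
ℝ[ suc n ] = poly-integralDomain ℝ[ n ]

module ℝ[x] n = IntegralDomain ℝ[ n ]

var : ∀ {n} → Fin n → ℝ[x].Carrier n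
var {suc n} zero    = Polynomial.X (ℝ[x].commutativeRing n)
var {suc n} (suc i) = Polynomial.const (ℝ[x].commutativeRing n) (var i)

∂ : ∀ {n} → Fin n → ℝ[x].Carrier n → ℝ[x].Carrier n
∂ {suc n} zero    = Polynomial.derivative (ℝ[x].commutativeRing n)
∂ {suc n} (suc i) = map (∂ i)

module FieldOfFractions (R : IntegralDomain) where

  open IntegralDomain R
  open RingProperties ring using (-‿distribˡ-*)
  open NatSolver commutativeSemiring using (solve; con; _:=_; _:+_; _:*_)
  open import Relation.Binary.Reasoning.Setoid setoid

  record Frac : Set where
    constructor _/_[_]
    field
      num : Carrier
      den : Carrier
      den≉0 : ¬ den ≈ 0#
  open Frac public

  infix 4 _≃_
  record _≃_ (x y : Frac) : Set where
    constructor crossMultiplied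
    field cross : num x * den y ≈ num y * den x
  open _≃_ public

  embed : Carrier → Frac
  embed a = a / 1# [ 1≉0 ]

  infixl 6 _⊕_
  infixl 7 _⊗_

  _⊕_ : Frac → Frac → Frac
  (a / b [ b≉0 ]) ⊕ (c / d [ d≉0 ]) = (a * d + c * b) / (b * d) [ x*y≉0 b≉0 d≉0 ]

  _⊗_ : Frac → Frac → Frac
  (a / b [ b≉0 ]) ⊗ (c / d [ d≉0 ]) = (a * c) / (b * d) [ x*y≉0 b≉0 d≉0 ]

  ⊖_ : Frac → Frac
  ⊖ (a / b [ b≉0 ]) = (- a) / b [ b≉0 ]

  private
    ≃-trans : ∀ {x y z} → x ≃ y → y ≃ z → x ≃ z
    ≃-trans {a / b [ _ ]} {c / d [ d≉0 ]} {e / f [ _ ]} (crossMultiplied ad≈cb) (crossMultiplied cf≈ed) =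
      crossMultiplied $ *-cancelʳ-nonZero d≉0 $ begin
        a * f * d   ≈⟨ solve 3 (λ a f d → a :* f :* d := a :* d :* f) (CommutativeRing.refl commutativeRing) a f d ⟩
        a * d * f   ≈⟨ *-congʳ ad≈cb ⟩
        c * b * f   ≈⟨ solve 3 (λ c b f → c :* b :* f := c :* f :* b) (CommutativeRing.refl commutativeRing) c b f ⟩
        c * f * b   ≈⟨ *-congʳ cf≈ed ⟩
        e * d * b   ≈⟨ solve 3 (λ e d b → e :* d :* b := e :* b :* d) (CommutativeRing.refl commutativeRing) e d b ⟩
        e * b * d   ∎

    ⊕-cong : ∀ {x x′ y y′} → x ≃ x′ → y ≃ y′ → x ⊕ y ≃ x′ ⊕ y′
    ⊕-cong {a / b [ _ ]} {a′ / b′ [ _ ]} {c / d [ _ ]} {c′ / d′ [ _ ]} (crossMultiplied e) (crossMultiplied f) =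
      crossMultiplied $ begin
        (a * d + c * b) * (b′ * d′)
          ≈⟨ solve 6 (λ a b c d b′ d′ → (a :* d :+ c :* b) :* (b′ :* d′)
                        := (a :* b′) :* (d :* d′) :+ (c :* d′) :* (b :* b′))
               (CommutativeRing.refl commutativeRing) a b c d b′ d′ ⟩
        (a * b′) * (d * d′) + (c * d′) * (b * b′)   ≈⟨ +-cong (*-congʳ e) (*-congʳ f) ⟩
        (a′ * b) * (d * d′) + (c′ * d) * (b * b′)
          ≈⟨ solve 6 (λ a′ b c′ d b′ d′ → (a′ :* b) :* (d :* d′) :+ (c′ :* d) :* (b :* b′)
                        := (a′ :* d′ :+ c′ :* b′) :* (b :* d))
               (CommutativeRing.refl commutativeRing) a′ b c′ d b′ d′ ⟩
        (a′ * d′ + c′ * b′) * (b * d)               ∎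

    ⊗-cong : ∀ {x x′ y y′} → x ≃ x′ → y ≃ y′ → x ⊗ y ≃ x′ ⊗ y′
    ⊗-cong {a / b [ _ ]} {a′ / b′ [ _ ]} {c / d [ _ ]} {c′ / d′ [ _ ]} (crossMultiplied e) (crossMultiplied f) =
      crossMultiplied $ begin
        (a * c) * (b′ * d′)
          ≈⟨ solve 4 (λ a c b′ d′ → (a :* c) :* (b′ :* d′) := (a :* b′) :* (c :* d′))
               (CommutativeRing.refl commutativeRing) a c b′ d′ ⟩
        (a * b′) * (c * d′)   ≈⟨ *-cong e f ⟩
        (a′ * b) * (c′ * d)
          ≈⟨ solve 4 (λ a′ b c′ d → (a′ :* b) :* (c′ :* d) := (a′ :* c′) :* (b :* d))
               (CommutativeRing.refl commutativeRing) a′ b c′ d ⟩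
        (a′ * c′) * (b * d)   ∎

    ⊖-cong : ∀ {x y} → x ≃ y → ⊖ x ≃ ⊖ y
    ⊖-cong {a / b [ _ ]} {c / d [ _ ]} (crossMultiplied e) = crossMultiplied $ begin
      - a * d   ≈⟨ -‿distribˡ-* a d ⟨
      - (a * d) ≈⟨ -‿cong e ⟩
      - (c * b) ≈⟨ -‿distribˡ-* c b ⟩
      - c * b   ∎

    ⊕-comm : ∀ x y → x ⊕ y ≃ y ⊕ x
    ⊕-comm (a / b [ _ ]) (c / d [ _ ]) = crossMultiplied $
      solve 4 (λ a b c d → (a :* d :+ c :* b) :* (d :* b) := (c :* b :+ a :* d) :* (b :* d))
        (CommutativeRing.refl commutativeRing) a b c d

    ⊕-assoc : ∀ x y z → x ⊕ y ⊕ z ≃ x ⊕ (y ⊕ z)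
    ⊕-assoc (a / b [ _ ]) (c / d [ _ ]) (e / f [ _ ]) = crossMultiplied $
      solve 6 (λ a b c d e f →
          ((a :* d :+ c :* b) :* f :+ e :* (b :* d)) :* (b :* (d :* f))
        := (a :* (d :* f) :+ (c :* f :+ e :* d) :* b) :* (b :* d :* f))
        (CommutativeRing.refl commutativeRing) a b c d e f

    ⊕-identityˡ : ∀ x → embed 0# ⊕ x ≃ x
    ⊕-identityˡ (a / b [ _ ]) = crossMultiplied $
      solve 2 (λ a b → (con 0 :* b :+ a :* con 1) :* b := a :* (con 1 :* b))
        (CommutativeRing.refl commutativeRing) a b

    ⊕-inverseˡ : ∀ x → ⊖ x ⊕ x ≃ embed 0#
    ⊕-inverseˡ (a / b [ _ ]) = crossMultiplied $ begin
      (- a * b + a * b) * 1# ≈⟨ *-identityʳ _ ⟩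
      - a * b + a * b        ≈⟨ distribʳ b (- a) a ⟨
      (- a + a) * b          ≈⟨ *-congʳ (-‿inverseˡ a) ⟩
      0# * b                 ≈⟨ zeroˡ b ⟩
      0#                     ≈⟨ zeroˡ (b * b) ⟨
      0# * (b * b)           ∎

    ⊗-comm : ∀ x y → x ⊗ y ≃ y ⊗ x
    ⊗-comm (a / b [ _ ]) (c / d [ _ ]) = crossMultiplied $
      solve 4 (λ a b c d → (a :* c) :* (d :* b) := (c :* a) :* (b :* d))
        (CommutativeRing.refl commutativeRing) a b c d

    ⊗-assoc : ∀ x y z → x ⊗ y ⊗ z ≃ x ⊗ (y ⊗ z)
    ⊗-assoc (a / b [ _ ]) (c / d [ _ ]) (e / f [ _ ]) = crossMultiplied $
      solve 6 (λ a b c d e f → (a :* c :* e) :* (b :* (d :* f)) := (a :* (c :* e)) :* (b :* d :* f))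
        (CommutativeRing.refl commutativeRing) a b c d e f

    ⊗-identityˡ : ∀ x → embed 1# ⊗ x ≃ x
    ⊗-identityˡ (a / b [ _ ]) = crossMultiplied $
      solve 2 (λ a b → (con 1 :* a) :* b := a :* (con 1 :* b)) (CommutativeRing.refl commutativeRing) a b

    ⊗-distribˡ : ∀ x y z → x ⊗ (y ⊕ z) ≃ x ⊗ y ⊕ x ⊗ z
    ⊗-distribˡ (a / b [ _ ]) (c / d [ _ ]) (e / f [ _ ]) = crossMultiplied $
      solve 6 (λ a b c d e f →
          (a :* (c :* f :+ e :* d)) :* ((b :* d) :* (b :* f))
        := ((a :* c) :* (b :* f) :+ (a :* e) :* (b :* d)) :* (b :* (d :* f)))
        (CommutativeRing.refl commutativeRing) a b c d e f

  fracCommutativeRing : CommutativeRing 0ℓ 0ℓ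
  fracCommutativeRing = record
    { Carrier = Frac
    ; _≈_     = _≃_
    ; _+_     = _⊕_
    ; _*_     = _⊗_
    ; -_      = ⊖_
    ; 0#      = embed 0#
    ; 1#      = embed 1#
    ; isCommutativeRing = record
      { isRing = record
        { +-isAbelianGroup = record
          { isGroup = record
            { isMonoid = record
              { isSemigroup = record
                { isMagma = record
                  { isEquivalence = record
                    { refl  = crossMultiplied (CommutativeRing.refl commutativeRing)
                    ; sym   = λ e → crossMultiplied (sym (cross e))
                    ; trans = ≃-trans
                    }
                  ; ∙-cong = ⊕-cong
                  }
                ; assoc = ⊕-assoc
                }
              ; identity = ⊕-identityˡ , (λ x → ≃-trans (⊕-comm x (embed 0#)) (⊕-identityˡ x))
              }
            ; inverse = ⊕-inverseˡ , (λ x → ≃-trans (⊕-comm x (⊖ x)) (⊕-inverseˡ x))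
            ; ⁻¹-cong = ⊖-cong
            }
          ; comm = ⊕-comm
          }
        ; *-cong     = ⊗-cong
        ; *-assoc    = ⊗-assoc
        ; *-identity = ⊗-identityˡ , (λ x → ≃-trans (⊗-comm x (embed 1#)) (⊗-identityˡ x))
        ; distrib    = ⊗-distribˡ
                     , (λ x y z → ≃-trans (⊗-comm (y ⊕ z) x)
                         (≃-trans (⊗-distribˡ x y z) (⊕-cong (⊗-comm x y) (⊗-comm x z))))
        }
      ; *-comm = ⊗-comm
      }
    }

  inverse : ∀ x → ¬ x ≃ embed 0# → ∃ λ y → x ⊗ y ≃ embed 1#
  inverse (a / b [ b≉0 ]) x≄0 = b / a [ a≉0 ] , crossMultiplied
    (solve 2 (λ a b → (a :* b) :* con 1 := con 1 :* (b :* a)) (CommutativeRing.refl commutativeRing) a b)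
    where
    a≉0 : ¬ a ≈ 0#
    a≉0 a≈0 = x≄0 $ crossMultiplied $ trans (*-congʳ a≈0) (trans (zeroˡ 1#) (sym (zeroˡ b)))

-- ℝ(x₀,…,xₙ₋₁)

ℝ⟨_⟩ : ℕ → CommutativeRing 0ℓ 0ℓ
ℝ⟨ n ⟩ = FieldOfFractions.fracCommutativeRing ℝ[ n ]

Matrix : Set → ℕ → ℕ → Set
Matrix A m n = Fin m → Fin n → A

infix 10 _ᵀ
_ᵀ : ∀ {A m n} → Matrix A m n → Matrix A n m
(M ᵀ) i j = M j i

module MatrixAlgebra (R : CommutativeRing 0ℓ 0ℓ) where

  open CommutativeRing R
  open MonoidSum +-monoid public using (sum)

  I : ∀ {n} → Matrix Carrier n n
  I i j = if does (i Finₚ.≟ j) then 1# else 0#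

  infixl 6 _⊟_
  infixl 8 _⊠_
  infixr 7 _•_

  _⊟_ : ∀ {m n} → Matrix Carrier m n → Matrix Carrier m n → Matrix Carrier m n
  (A ⊟ B) i j = A i j - B i j

  _⊠_ : ∀ {l m n} → Matrix Carrier l m → Matrix Carrier m n → Matrix Carrier l n
  (A ⊠ B) i k = sum λ j → A i j * B j k

  _•_ : ∀ {m n} → Carrier → Matrix Carrier m n → Matrix Carrier m n
  (c • A) i j = c * A i j

  -- The rows of M whose index is in S are linearly independent.
  RowsIndependent : ∀ {m n} → Matrix Carrier m n → Subset m → Set
  RowsIndependent {m} {n} M S = (c : Fin m → Carrier) → (∀ i → i ∉ S → c i ≈ 0#) →
    (∀ j → sum (λ i → c i * M i j) ≈ 0#) → ∀ i → c i ≈ 0#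

  ColumnsIndependent : ∀ {m n} → Matrix Carrier m n → Subset n → Set
  ColumnsIndependent M = RowsIndependent (M ᵀ)

  record HasRowRank {m n} (M : Matrix Carrier m n) (r : ℕ) : Set where
    field
      attained : ∃ λ S → RowsIndependent M S × ∣ S ∣ ≡ r
      maximal  : ∀ S → RowsIndependent M S → ∣ S ∣ ℕ.≤ r

-- A matroid on Fin n is presented by its family of independent sets.

IsBasis : ∀ {n} → (Subset n → Set) → Subset n → Set
IsBasis Independent B = Independent B × (∀ B′ → Independent B′ → B ⊆ B′ → B ≡ B′)

-- V = Fin n; the edge set D is listed without repetition, so |D| is the
-- length of the list and position e of the list carries the variable λ_e.

record Digraph (n : ℕ) : Set where
  field
    D        : List (Fin n × Fin n)
    unique   : Unique D
    loopless : ∀ {i j} → (i , j) List.∈ D → i ≢ j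

  ∣D∣ : ℕ
  ∣D∣ = length D

Simple : ∀ {n} → Digraph n → Set
Simple G = ∀ {i j} → ¬ ((i , j) List.∈ D × (j , i) List.∈ D)
  where open Digraph G

-- The pairs (i , j) with i ≤ j, which index the coordinates K_ij.

pairs : ∀ n → List (Fin n × Fin n)
pairs n = filter (uncurry Finₚ._≤?_) (cartesianProduct (allFin n) (allFin n))

module _ {n} (G : Digraph n) where

  open Digraph G

  -- Variables λ_e come first, in the order of D, and s is the last one.

  open ℝ[x] (suc ∣D∣) using () renaming (Carrier to ℝ[λ,s]; 0# to 0ₚ)
  open MatrixAlgebra (ℝ[x].commutativeRing (suc ∣D∣)) using (I; _⊟_; _⊠_; _•_)
  open MatrixAlgebra ℝ⟨ suc ∣D∣ ⟩ using (ColumnsIndependent)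

  s : ℝ[λ,s]
  s = var (fromℕ ∣D∣)

  _∈D? : (e : Fin n × Fin n) → Dec (e List.∈ D)
  e ∈D? = e ∈? D
    where open import Data.List.Membership.DecPropositional (≡-dec Finₚ._≟_ Finₚ._≟_) using (_∈?_)

  Λ : Matrix ℝ[λ,s] n n
  Λ i j with (i , j) ∈D?
  ... | yes e = var (inject₁ (index e))
  ... | no  _ = 0ₚ

  ψ : Matrix ℝ[λ,s] n n
  ψ = s • (I ⊟ Λ) ⊠ (I ⊟ Λ) ᵀ

  -- For n = 0 this matrix has a row, for s, but no columns.

  Jacobian : Matrix (CommutativeRing.Carrier ℝ⟨ suc ∣D∣ ⟩) (suc ∣D∣) (length (pairs n))
  Jacobian r c = embed (∂ r (uncurry ψ (lookup (pairs n) c)))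
    where open FieldOfFractions ℝ[ suc ∣D∣ ] using (embed)

  JacobianMatroid : Subset (length (pairs n)) → Set
  JacobianMatroid = ColumnsIndependent Jacobian

{-# OPTIONS --safe #-}

-- At Λ = 0 the derivative of K_ij by λ_kl is −s if {i,j} = {k,l} and 0 otherwise
-- (for i ≠ j), and the derivative of K_ii by s is 1 while those by the λ's vanish.
-- As G is simple, distinct edges have distinct unordered pairs, so the columns
-- K_kl for the edges (k,l) together with one column K_ii form a monomial matrix at
-- Λ = 0, and the rows are independent there.  Independence passes from Λ = 0 to
-- polynomials, one variable λ at a time, because in a relation of lowest order in
-- λ the lowest coefficients are a relation at λ = 0; it then passes to the
-- fraction field by clearing denominators.  Once the rows are independent, row
-- rank equals column rank gives the size of the bases; the elimination is
-- fraction free, so it works in any domain and no zero test is needed.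

module Submission where

open import Defs
open import Data.Nat.Base using (ℕ; suc; NonZero)
open import Data.Fin.Subset using (Subset; ∣_∣)
open import Data.List.Base using (length)
open import Data.Product.Base using (_×_)
open import Relation.Binary.PropositionalEquality using (_≡_)

open import Level using (0ℓ)
open import Algebra.Bundles using (CommutativeRing)
open import Algebra.Morphism.Structures using (module RingMorphisms)
import Algebra.Properties.Ring as RingProperties
import Algebra.Properties.Semiring.Sum as SemiringSum
import Algebra.Solver.Ring.NaturalCoefficients.Default as NatSolver
open import Data.Nat.Base as ℕ using (zero; s≤s)
import Data.Nat.Properties as ℕₚ
open import Data.Fin.Base as Fin using (Fin; zero; suc; inject₁; fromℕ)
import Data.Fin.Properties as Finₚ
open import Data.Fin.Relation.Unary.Top using (view; ‵fromℕ; ‵inj₁)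
open import Data.Fin.Subset using (inside; outside; _∈_; _∉_; _∪_; ⁅_⁆; ⊤)
  renaming (_-_ to _∖_)
import Data.Fin.Subset.Properties as Subsetₚ
open import Data.List.Base using (List; []; _∷_; lookup)
import Data.List.Membership.Propositional as List
open import Data.List.Membership.Propositional.Properties
  using (∈-lookup; ∈-filter⁺; ∈-cartesianProduct⁺; ∈-allFin)
import Data.List.Relation.Unary.All as All
open import Data.List.Relation.Unary.AllPairs using (_∷_)
open import Data.List.Relation.Unary.Any using (index)
open import Data.List.Relation.Unary.Any.Properties using (lookup-index)
open import Data.List.Relation.Unary.Unique.Propositional using (Unique)
open import Data.Product.Base using (∃; _,_; proj₁; uncurry)
open import Data.Sum.Base as Sum using (_⊎_; inj₁; inj₂; [_,_]′)
open import Data.Vec.Base using ([]; _∷_; here; there)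
open import Function.Base using (_$_; _∘_)
open import Relation.Binary.PropositionalEquality as ≡ using (_≢_)
open import Relation.Nullary using (¬_; yes; no; contradiction)
open import Relation.Nullary.Decidable using (decidable-stable; dec-true; dec-false)
open import Relation.Nullary.Negation using (¬¬-map)

-- Finite sums and the identity matrix

module Sums (R : CommutativeRing 0ℓ 0ℓ) where

  open CommutativeRing R hiding (zero)
  open MatrixAlgebra R using (I)
  open SemiringSum semiring public
    using (sum; sum-cong-≋; sum-replicate-zero; ∑-distrib-+; ∑-comm; *-distribˡ-sum; *-distribʳ-sum)
  open import Relation.Binary.Reasoning.Setoid setoid

  sum-zero : ∀ {n} {f : Fin n → Carrier} → (∀ i → f i ≈ 0#) → sum f ≈ 0#
  sum-zero {n} f≈0 = trans (sum-cong-≋ f≈0) (sum-replicate-zero n)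

  I-diagonal : ∀ {n} (i : Fin n) → I i i ≈ 1#
  I-diagonal i rewrite dec-true (i Finₚ.≟ i) ≡.refl = refl

  I-offDiagonal : ∀ {n} {i j : Fin n} → i ≢ j → I i j ≈ 0#
  I-offDiagonal {i = i} {j} i≢j rewrite dec-false (i Finₚ.≟ j) i≢j = refl

  I-sym : ∀ {n} (i j : Fin n) → I i j ≈ I j i
  I-sym i j with i Finₚ.≟ j
  ... | yes ≡.refl = sym (I-diagonal i)
  ... | no  i≢j    = sym (I-offDiagonal (i≢j ∘ ≡.sym))

  sum-single : ∀ {n} {f : Fin n → Carrier} i → (∀ j → j ≢ i → f j ≈ 0#) → sum f ≈ f i
  sum-single {f = f} zero    f≈0 =
    trans (+-congˡ (sum-zero λ j → f≈0 (suc j) λ ())) (+-identityʳ (f zero))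
  sum-single {f = f} (suc i) f≈0 =
    trans (+-cong (f≈0 zero λ ()) (sum-single i λ j j≢i → f≈0 (suc j) (j≢i ∘ Finₚ.suc-injective)))
          (+-identityˡ (f (suc i)))

  sum-I : ∀ {n} i (f : Fin n → Carrier) → sum (λ j → I i j * f j) ≈ f i
  sum-I i f = begin
    sum (λ j → I i j * f j) ≈⟨ sum-single i (λ j j≢i →
                                 trans (*-congʳ (I-offDiagonal (j≢i ∘ ≡.sym))) (zeroˡ (f j))) ⟩
    I i i * f i             ≈⟨ *-congʳ (I-diagonal i) ⟩
    1# * f i                ≈⟨ *-identityˡ (f i) ⟩
    f i                     ∎

-- Removing one element from a finite subset

x∉p-x : ∀ {n} (p : Subset n) x → x ∉ p ∖ x
x∉p-x p x x∈p-x =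
  ℕₚ.<-irrefl (≡.cong ∣_∣ (Subsetₚ.p─q─q≡p─q p ⁅ x ⁆)) (Subsetₚ.x∈p⇒∣p-x∣<∣p∣ x∈p-x)

∣p∣≤1+∣p-x∣ : ∀ {n} (p : Subset n) x → ∣ p ∣ ℕ.≤ suc ∣ p ∖ x ∣
∣p∣≤1+∣p-x∣ (outside ∷ p) zero    = ℕₚ.m≤n⇒m≤1+n (ℕₚ.≤-reflexive (≡.cong ∣_∣ (≡.sym (Subsetₚ.p─⊥≡p p))))
∣p∣≤1+∣p-x∣ (inside  ∷ p) zero    = s≤s (ℕₚ.≤-reflexive (≡.cong ∣_∣ (≡.sym (Subsetₚ.p─⊥≡p p))))
∣p∣≤1+∣p-x∣ (outside ∷ p) (suc x) = ∣p∣≤1+∣p-x∣ p x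
∣p∣≤1+∣p-x∣ (inside  ∷ p) (suc x) = s≤s (∣p∣≤1+∣p-x∣ p x)

-- Linear algebra over an integral domain: elimination, row rank and bases

module LinearAlgebra (R : IntegralDomain) where

  open IntegralDomain R hiding (zero)
  open MatrixAlgebra commutativeRing using (I; RowsIndependent; ColumnsIndependent)
  open RingProperties ring using (-‿distribˡ-*; -‿distribʳ-*)
  open Sums commutativeRing
  open NatSolver commutativeSemiring using (solve; _:=_; _:+_; _:*_)
  open import Relation.Binary.Reasoning.Setoid setoid

  -- With one factor known to be nonzero, `stable` turns the doubly negated zero-product law into a
  -- positive conclusion.
  x*y≈0⇒y≈0 : ∀ {x y} → ¬ x ≈ 0# → x * y ≈ 0# → y ≈ 0#
  x*y≈0⇒y≈0 x≉0 xy≈0 = stable λ y≉0 → x*y≉0 x≉0 y≉0 xy≈0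

  x*y≈0⇒x≈0 : ∀ {x y} → ¬ y ≈ 0# → x * y ≈ 0# → x ≈ 0#
  x*y≈0⇒x≈0 y≉0 xy≈0 = x*y≈0⇒y≈0 y≉0 (trans (*-comm _ _) xy≈0)

  -- Columns are restricted by a subset rather than by forming a submatrix, so that `T` can be a
  -- basis of the column matroid and the induction on rank can run along `T`.
  RowsIndependentOn : ∀ {m n} → Matrix Carrier m n → Subset m → Subset n → Set
  RowsIndependentOn {m} M S T = (c : Fin m → Carrier) → (∀ i → i ∉ S → c i ≈ 0#) →
    (∀ j → j ∈ T → sum (λ i → c i * M i j) ≈ 0#) → ∀ i → c i ≈ 0#

  private
    combine : ∀ {n} a b (f g : Fin n → Carrier) →
      sum (λ i → a * f i + g i * b) ≈ a * sum f + sum g * b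
    combine a b f g = trans (∑-distrib-+ (λ i → a * f i) (λ i → g i * b))
      (sym (+-cong (*-distribˡ-sum a f) (*-distribʳ-sum b g)))

  dropColumns : ∀ {m n} → Matrix Carrier m (suc n) → Matrix Carrier m n
  dropColumns M i j = M i (suc j)

  -- A Gaussian step without division: row `l` is scaled by the pivot `M i zero` before a multiple
  -- of row `i` is subtracted. Row `i` itself becomes zero and is removed from `S` afterwards.
  eliminate : ∀ {m n} → Fin m → Matrix Carrier m (suc n) → Matrix Carrier m n
  eliminate i M l j = M i zero * M l (suc j) + M l zero * - M i (suc j)

  drop-outside : ∀ {m n} {M : Matrix Carrier m (suc n)} {S T} →
    RowsIndependentOn M S (outside ∷ T) → RowsIndependentOn (dropColumns M) S T
  drop-outside indep c c∉S≈0 cM≈0 = indep c c∉S≈0 λ { (suc j) (there j∈T) → cM≈0 j j∈T }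

  -- The equation of the dropped column holds term by term: on `S` the entry vanishes, off `S` the
  -- coefficient does.
  drop-zero : ∀ {m n} {M : Matrix Carrier m (suc n)} {S T} → (∀ i → i ∈ S → M i zero ≈ 0#) →
    RowsIndependentOn M S (inside ∷ T) → RowsIndependentOn (dropColumns M) S T
  drop-zero {M = M} {S} M₀≈0 indep c c∉S≈0 cM≈0 = indep c c∉S≈0 λ where
      zero    here        → sum-zero vanish
      (suc j) (there j∈T) → cM≈0 j j∈T
    where
    vanish : ∀ i → c i * M i zero ≈ 0#
    vanish i with i Subsetₚ.∈? S
    ... | yes i∈S = trans (*-congˡ (M₀≈0 i i∈S)) (zeroʳ (c i))
    ... | no  i∉S = trans (*-congʳ (c∉S≈0 i i∉S)) (zeroˡ (M i zero))

  -- A relation `c` among the eliminated rows lifts to a relation `c′` among the original ones that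
  -- differs from `p * c` only at row `i`. Independence makes `c′` vanish, and away from `i` the
  -- pivot cancels.
  eliminate-independent : ∀ {m n} {M : Matrix Carrier m (suc n)} {S T} i → i ∈ S → ¬ M i zero ≈ 0# →
    RowsIndependentOn M S (inside ∷ T) → RowsIndependentOn (eliminate i M) (S ∖ i) T
  eliminate-independent {m} {M = M} {S} {T} i i∈S p≉0 indep c c∉≈0 cM≈0 l with l Finₚ.≟ i
  ... | yes ≡.refl = c∉≈0 i (x∉p-x S i)
  ... | no  l≢i    = x*y≈0⇒y≈0 p≉0 $ begin
    p * c l              ≈⟨ +-identityʳ _ ⟨
    p * c l + 0#         ≈⟨ +-congˡ (trans (*-congʳ (I-offDiagonal (l≢i ∘ ≡.sym))) (zeroˡ (- t))) ⟨
    c′ l                 ≈⟨ indep c′ c′∉S≈0 (λ { _ here → c′M₀≈0 ; (suc j) (there j∈T) → c′M≈0 j j∈T }) l ⟩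
    0#                   ∎
    where
    p t : Carrier
    p = M i zero
    t = sum λ k → c k * M k zero

    -- `I i k` is the indicator of row `i`. The correction `- t` there makes the first column sum to
    -- `p * t - p * t`; in the other columns it produces the subtracted terms of `eliminate`.
    c′ : Fin m → Carrier
    c′ k = p * c k + I i k * - t

    c′∉S≈0 : ∀ k → k ∉ S → c′ k ≈ 0#
    c′∉S≈0 k k∉S = begin
      p * c k + I i k * - t ≈⟨ +-cong (*-congˡ (c∉≈0 k (k∉S ∘ Subsetₚ.p─q⊆p S ⁅ i ⁆)))
                                      (*-congʳ (I-offDiagonal {i = i} {k} λ { ≡.refl → k∉S i∈S })) ⟩
      p * 0# + 0# * - t     ≈⟨ +-cong (zeroʳ p) (zeroˡ (- t)) ⟩
      0# + 0#               ≈⟨ +-identityˡ 0# ⟩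
      0#                    ∎

    sum-c′ : ∀ (x : Fin m → Carrier) → sum (λ k → c′ k * x k) ≈ p * sum (λ k → c k * x k) + x i * - t
    sum-c′ x = begin
      sum (λ k → c′ k * x k)
        ≈⟨ sum-cong-≋ (λ k → solve 5 (λ p c e t x → (p :* c :+ e :* t) :* x := p :* (c :* x) :+ (e :* x) :* t)
             refl p (c k) (I i k) (- t) (x k)) ⟩
      sum (λ k → p * (c k * x k) + I i k * x k * - t)                ≈⟨ combine p (- t) (λ k → c k * x k) (λ k → I i k * x k) ⟩
      p * sum (λ k → c k * x k) + sum (λ k → I i k * x k) * - t      ≈⟨ +-congˡ (*-congʳ (sum-I i x)) ⟩
      p * sum (λ k → c k * x k) + x i * - t                          ∎

    c′M₀≈0 : sum (λ k → c′ k * M k zero) ≈ 0#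
    c′M₀≈0 = begin
      sum (λ k → c′ k * M k zero) ≈⟨ sum-c′ (λ k → M k zero) ⟩
      p * t + p * - t             ≈⟨ distribˡ p t (- t) ⟨
      p * (t + - t)               ≈⟨ *-congˡ (-‿inverseʳ t) ⟩
      p * 0#                      ≈⟨ zeroʳ p ⟩
      0#                          ∎

    c′M≈0 : ∀ j → j ∈ T → sum (λ k → c′ k * M k (suc j)) ≈ 0#
    c′M≈0 j j∈T = begin
      sum (λ k → c′ k * M k (suc j))                            ≈⟨ sum-c′ (λ k → M k (suc j)) ⟩
      p * sum (λ k → c k * M k (suc j)) + M i (suc j) * - t     ≈⟨ +-congˡ (trans (sym (-‿distribʳ-* _ t)) (-‿distribˡ-* _ t)) ⟩
      p * sum (λ k → c k * M k (suc j)) + - M i (suc j) * t     ≈⟨ +-congˡ (*-comm _ t) ⟩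
      p * sum (λ k → c k * M k (suc j)) + t * - M i (suc j)     ≈⟨ combine p (- M i (suc j)) (λ k → c k * M k (suc j)) (λ k → c k * M k zero) ⟨
      sum (λ k → p * (c k * M k (suc j)) + c k * M k zero * - M i (suc j))
        ≈⟨ sum-cong-≋ (λ k → solve 5 (λ p c x y u → p :* (c :* x) :+ (c :* y) :* u := c :* (p :* x :+ y :* u))
             refl p (c k) (M k (suc j)) (M k zero) (- M i (suc j))) ⟩
      sum (λ k → c k * eliminate i M k j)                       ≈⟨ cM≈0 j j∈T ⟩
      0#                                                        ∎

  independentOn⇒∣S∣≤∣T∣ : ∀ {m n} (M : Matrix Carrier m n) S T → RowsIndependentOn M S T → ∣ S ∣ ℕ.≤ ∣ T ∣
  independentOn⇒∣S∣≤∣T∣ {m} M S [] indep = ℕₚ.≤-reflexive $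
    ≡.trans (≡.cong ∣_∣ (Subsetₚ.Empty-unique S-empty)) (Subsetₚ.∣⊥∣≡0 m)
    where
    S-empty : ¬ ∃ λ i → i ∈ S
    S-empty (i , i∈S) = 1≉0 $ trans (sym (I-diagonal i)) $
      -- With no columns every coefficient vector supported on `S` is a relation, in particular the
      -- unit vector at `i`.
      indep (I i) (λ k k∉S → I-offDiagonal {i = i} {k} λ { ≡.refl → k∉S i∈S }) (λ ()) i
  independentOn⇒∣S∣≤∣T∣ M S (outside ∷ T) indep =
    independentOn⇒∣S∣≤∣T∣ (dropColumns M) S T (drop-outside {M = M} indep)
  -- Since `≤` on naturals is decidable, the bound may be assumed false. A nonzero pivot would give
  -- the bound by elimination, so by `stable` the whole column vanishes on `S`.
  independentOn⇒∣S∣≤∣T∣ M S (inside ∷ T) indep = decidable-stable (∣ S ∣ ℕₚ.≤? suc ∣ T ∣) λ S≰1+T →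
    S≰1+T $ ℕₚ.m≤n⇒m≤1+n $ independentOn⇒∣S∣≤∣T∣ (dropColumns M) S T $
    drop-zero {M = M} (λ i i∈S → stable λ Mᵢ₀≉0 → S≰1+T $ ℕₚ.≤-trans (∣p∣≤1+∣p-x∣ S i) $ s≤s $
      independentOn⇒∣S∣≤∣T∣ (eliminate i M) (S ∖ i) T (eliminate-independent {M = M} i i∈S Mᵢ₀≉0 indep)) indep

  independent⇒∣S∣≤n : ∀ {m n} (M : Matrix Carrier m n) S → RowsIndependent M S → ∣ S ∣ ℕ.≤ n
  independent⇒∣S∣≤n {n = n} M S indep = ≡.subst (∣ S ∣ ℕ.≤_) (Subsetₚ.∣⊤∣≡n n) $
    independentOn⇒∣S∣≤∣T∣ M S ⊤ λ c c∉S≈0 cM≈0 → indep c c∉S≈0 λ j → cM≈0 j Subsetₚ.∈⊤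

  FullRowRank : ∀ {m n} → Matrix Carrier m n → Set
  FullRowRank {m} M = (c : Fin m → Carrier) → (∀ j → sum (λ i → c i * M i j) ≈ 0#) → ∀ i → c i ≈ 0#

  -- The column chosen for row `i` has its only nonzero entry there, so its equation reads
  -- `c i * u ≈ 0#`.
  fullRowRank-monomial : ∀ {m n} {M : Matrix Carrier m n} →
    (∀ i → ∃ λ j → ∃ λ u → ¬ u ≈ 0# × ∀ k → M k j ≈ I i k * u) → FullRowRank M
  fullRowRank-monomial {M = M} monomial c cM≈0 i with monomial i
  ... | j , u , u≉0 , column = x*y≈0⇒x≈0 u≉0 $ begin
    c i * u                       ≈⟨ sum-I i (λ k → c k * u) ⟨
    sum (λ k → I i k * (c k * u)) ≈⟨ sum-cong-≋ (λ k → trans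
                                       (solve 3 (λ e c u → e :* (c :* u) := c :* (e :* u)) refl (I i k) (c k) u)
                                       (*-congˡ (sym (column k)))) ⟩
    sum (λ k → c k * M k j)       ≈⟨ cM≈0 j ⟩
    0#                            ∎

  fullRowRank⇒hasRowRank : ∀ {m n} {M : Matrix Carrier m n} →
    FullRowRank M → MatrixAlgebra.HasRowRank commutativeRing M m
  fullRowRank⇒hasRowRank {m} full = record
    { attained = ⊤ , (λ c _ → full c) , Subsetₚ.∣⊤∣≡n m
    ; maximal  = λ S _ → Subsetₚ.∣p∣≤n S
    }

  -- A column j outside a basis B has a relation d to B with d j ≉ 0, so a row
  -- combination that kills the columns in B also kills column j.
  basis⇒rowsIndependentOn : ∀ {m n} {M : Matrix Carrier m n} {B} → FullRowRank M →
    IsBasis (ColumnsIndependent M) B → RowsIndependentOn M ⊤ B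
  basis⇒rowsIndependentOn {m} {n} {M} {B} full (indep , maximal) c _ cM∈B≈0 = full c λ j → stable (cM≉0⇒⊥ j)
    where
    cM : Fin n → Carrier
    cM j = sum λ i → c i * M i j

    -- Associativity of the product c M d: a relation `d` among the columns annihilates the vector
    -- `cM`.
    swap : ∀ d → (∀ i → sum (λ k → d k * M i k) ≈ 0#) → sum (λ k → d k * cM k) ≈ 0#
    swap d Md≈0 = begin
      sum (λ k → d k * cM k)                       ≈⟨ sum-cong-≋ (λ k → *-distribˡ-sum (d k) (λ i → c i * M i k)) ⟩
      sum (λ k → sum λ i → d k * (c i * M i k))    ≈⟨ ∑-comm (λ k i → d k * (c i * M i k)) ⟩
      sum (λ i → sum λ k → d k * (c i * M i k))
        ≈⟨ sum-cong-≋ (λ i → sum-cong-≋ λ k →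
             solve 3 (λ d c x → d :* (c :* x) := c :* (d :* x)) refl (d k) (c i) (M i k)) ⟩
      sum (λ i → sum λ k → c i * (d k * M i k))    ≈⟨ sum-cong-≋ (λ i → *-distribˡ-sum (c i) (λ k → d k * M i k)) ⟨
      sum (λ i → c i * sum λ k → d k * M i k)      ≈⟨ sum-zero (λ i → trans (*-congˡ (Md≈0 i)) (zeroʳ (c i))) ⟩
      0#                                           ∎

    -- Argued by contraposition: if `cM j` were nonzero, any relation supported on `B ∪ ⁅ j ⁆` would
    -- have zero coefficient at `j`, so this larger set would be independent, against maximality.
    cM≉0⇒⊥ : ∀ j → ¬ ¬ cM j ≈ 0#
    cM≉0⇒⊥ j cMⱼ≉0 = j∉B $ ≡.subst (j ∈_) (≡.sym (maximal (B ∪ ⁅ j ⁆) B∪j-independent (Subsetₚ.p⊆p∪q ⁅ j ⁆)))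
      (Subsetₚ.x∈p∪q⁺ (inj₂ (Subsetₚ.x∈⁅x⁆ j)))
      where
      j∉B : j ∉ B
      j∉B j∈B = cMⱼ≉0 (cM∈B≈0 j j∈B)

      B∪j-independent : ColumnsIndependent M (B ∪ ⁅ j ⁆)
      B∪j-independent d d∉≈0 Md≈0 = indep d d∉B≈0 Md≈0
        where
        d∉B≈0′ : ∀ k → k ∉ B → k ≢ j → d k ≈ 0#
        d∉B≈0′ k k∉B k≢j = d∉≈0 k ([ k∉B , k≢j ∘ Subsetₚ.x∈⁅y⁆⇒x≡y j ]′ ∘ Subsetₚ.x∈p∪q⁻ B ⁅ j ⁆)

        other : ∀ k → k ≢ j → d k * cM k ≈ 0#
        other k k≢j with k Subsetₚ.∈? B
        ... | yes k∈B = trans (*-congˡ (cM∈B≈0 k k∈B)) (zeroʳ (d k))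
        ... | no  k∉B = trans (*-congʳ (d∉B≈0′ k k∉B k≢j)) (zeroˡ (cM k))

        dⱼ≈0 : d j ≈ 0#
        dⱼ≈0 = x*y≈0⇒x≈0 cMⱼ≉0 (trans (sym (sum-single j other)) (swap d Md≈0))

        d∉B≈0 : ∀ k → k ∉ B → d k ≈ 0#
        d∉B≈0 k k∉B with k Finₚ.≟ j
        ... | yes ≡.refl = dⱼ≈0
        ... | no  k≢j    = d∉B≈0′ k k∉B k≢j

  -- Both inequalities are the same rank bound, applied once to the transpose with the columns in
  -- `B`, and once to all `m` rows restricted to those columns.
  basis-size : ∀ {m n} {M : Matrix Carrier m n} {B} → FullRowRank M →
    IsBasis (ColumnsIndependent M) B → ∣ B ∣ ≡ m
  basis-size {m} {M = M} {B} full basis = ℕₚ.≤-antisym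
    (independent⇒∣S∣≤n (M ᵀ) B (proj₁ basis))
    (≡.subst (ℕ._≤ ∣ B ∣) (Subsetₚ.∣⊤∣≡n m)
      (independentOn⇒∣S∣≤∣T∣ M ⊤ B (basis⇒rowsIndependentOn full basis)))

-- Passage to the fraction field

module Fractions (R : IntegralDomain) where

  open IntegralDomain R hiding (zero)
  open FieldOfFractions R
  open LinearAlgebra R using (FullRowRank; x*y≈0⇒x≈0)
  open MatrixAlgebra commutativeRing using (sum)
  open NatSolver commutativeSemiring using (solve; con; _:=_; _:+_; _:*_)
  private
    module F = CommutativeRing fracCommutativeRing
    module FSums = Sums fracCommutativeRing

  num≈0⇒≃0 : ∀ {x} → num x ≈ 0# → x ≃ embed 0#
  num≈0⇒≃0 {a / b [ _ ]} a≈0 = crossMultiplied (trans (*-congʳ a≈0) (trans (zeroˡ 1#) (sym (zeroˡ b))))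

  ≃0⇒num≈0 : ∀ {x} → x ≃ embed 0# → num x ≈ 0#
  ≃0⇒num≈0 {a / b [ _ ]} (crossMultiplied e) = trans (sym (*-identityʳ a)) (trans e (zeroˡ b))

  -- A fraction vanishes exactly when its numerator does, so the laws descend from `R`; this makes
  -- the linear algebra above available over the fraction field.
  integralDomain : IntegralDomain
  integralDomain = record
    { commutativeRing = fracCommutativeRing
    ; 1≉0    = λ e → 1≉0 (≃0⇒num≈0 e)
    ; stable = λ ¬x≄y → crossMultiplied (stable λ ¬cross → ¬x≄y (¬cross ∘ cross))
    ; x*y≈0⇒¬¬x≈0∨y≈0 = λ xy≃0 →
        ¬¬-map (Sum.map num≈0⇒≃0 num≈0⇒≃0) (x*y≈0⇒¬¬x≈0∨y≈0 (≃0⇒num≈0 xy≃0))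
    }

  embed-+ : ∀ a b → embed (a + b) ≃ embed a ⊕ embed b
  embed-+ a b = crossMultiplied $
    solve 2 (λ a b → (a :+ b) :* (con 1 :* con 1) := (a :* con 1 :+ b :* con 1) :* con 1) refl a b

  embed-sum : ∀ {n} (f : Fin n → Carrier) → embed (sum f) ≃ MatrixAlgebra.sum fracCommutativeRing (embed ∘ f)
  embed-sum {zero}  f = F.refl
  embed-sum {suc n} f = F.trans (embed-+ (f zero) (sum (f ∘ suc))) (F.+-congˡ {embed (f zero)} (embed-sum (f ∘ suc)))

  commonDenominator : ∀ {m} (c : Fin m → Frac) →
    ∃ λ d → ¬ d ≈ 0# × ∃ λ (a : Fin m → Carrier) → ∀ i → embed d ⊗ c i ≃ embed (a i)
  commonDenominator {zero}  c = 1# , 1≉0 , (λ ()) , λ ()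
  commonDenominator {suc m} c with c zero in c₀≡ | commonDenominator (c ∘ suc)
  ... | a₀ / b₀ [ b₀≉0 ] | d , d≉0 , a , dc≃a = d * b₀ , x*y≉0 d≉0 b₀≉0 ,
    -- Over the denominator `d * b₀` the head still needs the factor `d`, and the already cleared
    -- tail the factor `b₀`.
    (λ { zero → d * a₀ ; (suc i) → b₀ * a i }) , λ where
      zero    → ≡.subst (λ x → embed (d * b₀) ⊗ x ≃ embed (d * a₀)) (≡.sym c₀≡) $ crossMultiplied $
        solve 3 (λ d b a → d :* b :* a :* con 1 := d :* a :* (con 1 :* b)) refl d b₀ a₀
      (suc i) → crossMultiplied $ begin
        d * b₀ * num (c (suc i)) * 1#      ≈⟨ solve 3 (λ d b x → d :* b :* x :* con 1 := b :* (d :* x :* con 1)) refl d b₀ _ ⟩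
        b₀ * (d * num (c (suc i)) * 1#)    ≈⟨ *-congˡ (cross (dc≃a i)) ⟩
        b₀ * (a i * (1# * den (c (suc i)))) ≈⟨ *-assoc b₀ _ _ ⟨
        b₀ * a i * (1# * den (c (suc i)))  ∎
    where
    open import Relation.Binary.Reasoning.Setoid setoid

  embed-fullRowRank : ∀ {m n} {M : Matrix Carrier m n} → FullRowRank M →
    LinearAlgebra.FullRowRank integralDomain (λ i j → embed (M i j))
  embed-fullRowRank {m} {n} {M} full c cM≃0 i with commonDenominator c
  -- The cleared coefficient `a i` vanishes, hence so does the numerator `d * num (c i)` of
  -- `embed d ⊗ c i`, and `d` cancels.
  ... | d , d≉0 , a , dc≃a = num≈0⇒≃0 $ x*y≈0⇒x≈0 d≉0 $ trans (*-comm _ d) $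
    ≃0⇒num≈0 (F.trans (dc≃a i) (crossMultiplied (*-congʳ (full a aM≈0 i))))
    where
    open import Relation.Binary.Reasoning.Setoid F.setoid
    aM≈0 : ∀ j → sum (λ i → a i * M i j) ≈ 0#
    aM≈0 j = ≃0⇒num≈0 $ begin
      embed (sum λ i → a i * M i j)                    ≈⟨ embed-sum (λ i → a i * M i j) ⟩
      FSums.sum (λ i → embed (a i * M i j))            ≈⟨ FSums.sum-cong-≋ (λ i → step i) ⟩
      FSums.sum (λ i → embed d ⊗ (c i ⊗ embed (M i j))) ≈⟨ FSums.*-distribˡ-sum (embed d) (λ i → c i ⊗ embed (M i j)) ⟨
      embed d ⊗ FSums.sum (λ i → c i ⊗ embed (M i j))  ≈⟨ F.*-congˡ {embed d} (cM≃0 j) ⟩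
      embed d ⊗ embed 0#                               ≈⟨ F.zeroʳ (embed d) ⟩
      embed 0#                                         ∎
      where
      step : ∀ i → embed (a i * M i j) ≃ embed d ⊗ (c i ⊗ embed (M i j))
      step i = begin
        embed (a i * M i j)              ≈⟨ crossMultiplied (*-congˡ (*-identityˡ 1#)) ⟩
        embed (a i) ⊗ embed (M i j)      ≈⟨ F.*-congʳ {embed (M i j)} (dc≃a i) ⟨
        embed d ⊗ c i ⊗ embed (M i j)    ≈⟨ F.*-assoc (embed d) (c i) (embed (M i j)) ⟩
        embed d ⊗ (c i ⊗ embed (M i j))  ∎

-- Lifting full row rank from constant terms to polynomials

module Polynomials (R : IntegralDomain) where

  open IntegralDomain R hiding (zero)
  open Polynomial commutativeRing
  open LinearAlgebra R using (FullRowRank)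
  open MatrixAlgebra commutativeRing using (sum)
  open Sums commutativeRing using (sum-cong-≋)
  open import Relation.Binary.Reasoning.Setoid setoid
  private
    module P = CommutativeRing poly-commutativeRing
    module PSums = Sums poly-commutativeRing

  coeff-sum : ∀ {n} (f : Fin n → Poly) k → coeff (PSums.sum f) k ≈ sum (λ i → coeff (f i) k)
  coeff-sum {zero}  f k = refl
  coeff-sum {suc n} f k = trans (coeff-⊕ (f zero) (PSums.sum (f ∘ suc)) k) (+-congˡ (coeff-sum (f ∘ suc) k))

  coeff₀-⊗ : ∀ p q → coeff (p ⊗ q) 0 ≈ coeff p 0 * coeff q 0
  coeff₀-⊗ []      q = sym (zeroˡ (coeff q 0))
  coeff₀-⊗ (a ∷ p) q = begin
    coeff (a · q ⊕ X· (p ⊗ q)) 0 ≈⟨ coeff-⊕ (a · q) (X· (p ⊗ q)) 0 ⟩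
    coeff (a · q) 0 + 0#         ≈⟨ +-identityʳ _ ⟩
    coeff (a · q) 0              ≈⟨ coeff-· a q 0 ⟩
    a * coeff q 0                ∎

  tail : Poly → Poly
  tail []      = []
  tail (_ ∷ p) = p

  coeff-suc-⊗ : ∀ p q k → coeff (p ⊗ q) (suc k) ≈ coeff p 0 * coeff q (suc k) + coeff (tail p ⊗ q) k
  coeff-suc-⊗ []      q k = trans (sym (+-identityʳ 0#)) (+-congʳ (sym (zeroˡ (coeff q (suc k)))))
  coeff-suc-⊗ (a ∷ p) q k = trans (coeff-⊕ (a · q) (X· (p ⊗ q)) (suc k)) (+-congʳ (coeff-· a q (suc k)))

  coeff-tail : ∀ p k → coeff (tail p) k ≈ coeff p (suc k)
  coeff-tail []      k = refl
  coeff-tail (_ ∷ p) k = refl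

  coeff₁-⊗ : ∀ p q → coeff (p ⊗ q) 1 ≈ coeff p 0 * coeff q 1 + coeff p 1 * coeff q 0
  coeff₁-⊗ p q = trans (coeff-suc-⊗ p q 0) (+-congˡ (trans (coeff₀-⊗ (tail p) q) (*-congʳ (coeff-tail p 0))))

  -- If X divides every entry of c and cM = 0, then (c/X) M = 0 as well; so the
  -- constant terms alone force all coefficients of c to vanish, one at a time.
  fullRowRank-lift : ∀ {m n} {M : Matrix Poly m n} → FullRowRank (λ i j → coeff (M i j) 0) →
    LinearAlgebra.FullRowRank (poly-integralDomain R) M
  fullRowRank-lift {m} {n} {M} full c cM≋0 i = coeffwise λ k → vanish k c cM≋0 i
    where
    -- The relation is quantified inside the induction on `k`, because the step replaces `c` by
    -- `tail ∘ c`.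
    vanish : ∀ k (c : Fin m → Poly) → (∀ j → PSums.sum (λ i → c i ⊗ M i j) ≋ []) → ∀ i → coeff (c i) k ≈ 0#
    vanish zero c cM≋0 = full (λ i → coeff (c i) 0) λ j → begin
      sum (λ i → coeff (c i) 0 * coeff (M i j) 0) ≈⟨ sum-cong-≋ (λ i → coeff₀-⊗ (c i) (M i j)) ⟨
      sum (λ i → coeff (c i ⊗ M i j) 0)           ≈⟨ coeff-sum (λ i → c i ⊗ M i j) 0 ⟨
      coeff (PSums.sum (λ i → c i ⊗ M i j)) 0     ≈⟨ at (cM≋0 j) 0 ⟩
      0#                                          ∎
    vanish (suc k) c cM≋0 i = trans (sym (coeff-tail (c i) k)) $ vanish k (tail ∘ c) tail-cM≋0 i
      where
      tail-cM≋0 : ∀ j → PSums.sum (λ i → tail (c i) ⊗ M i j) ≋ []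
      tail-cM≋0 j = coeffwise λ l → begin
        coeff (PSums.sum (λ i → tail (c i) ⊗ M i j)) l   ≈⟨ coeff-sum (λ i → tail (c i) ⊗ M i j) l ⟩
        sum (λ i → coeff (tail (c i) ⊗ M i j) l)         ≈⟨ sum-cong-≋ (λ i → shift i l) ⟩
        sum (λ i → coeff (c i ⊗ M i j) (suc l))          ≈⟨ coeff-sum (λ i → c i ⊗ M i j) (suc l) ⟨
        coeff (PSums.sum (λ i → c i ⊗ M i j)) (suc l)    ≈⟨ at (cM≋0 j) (suc l) ⟩
        0#                                               ∎
        where
        -- The constant term of `c i` is already known to vanish, so passing to its tail only shifts
        -- the coefficients of the product.
        shift : ∀ i l → coeff (tail (c i) ⊗ M i j) l ≈ coeff (c i ⊗ M i j) (suc l)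
        shift i l = sym $ begin
          coeff (c i ⊗ M i j) (suc l)
            ≈⟨ coeff-suc-⊗ (c i) (M i j) l ⟩
          coeff (c i) 0 * coeff (M i j) (suc l) + coeff (tail (c i) ⊗ M i j) l
            ≈⟨ +-congʳ (trans (*-congʳ (vanish zero c cM≋0 i)) (zeroˡ _)) ⟩
          0# + coeff (tail (c i) ⊗ M i j) l
            ≈⟨ +-identityˡ _ ⟩
          coeff (tail (c i) ⊗ M i j) l ∎

-- The formal derivative in one variable

module Derivatives (R : CommutativeRing 0ℓ 0ℓ) where

  open CommutativeRing R using (trans; sym; +-congˡ; +-identityʳ; _≈_)
  open Polynomial R
  open import Algebra.Properties.Monoid.Mult (CommutativeRing.+-monoid R)
    using (×-congʳ; ×-idem) renaming (_×_ to _×ₙ_)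
  private
    module P = CommutativeRing poly-commutativeRing
  open import Algebra.Properties.CommutativeSemigroup P.+-commutativeSemigroup using (interchange)
  open import Relation.Binary.Reasoning.Setoid P.setoid

  -- Equal polynomials may differ as lists by trailing zeros, so the recursion does not show that
  -- `derivative` respects `_≋_`; this coefficient formula does.
  coeff-derivative : ∀ p i → coeff (derivative p) i ≈ suc i ×ₙ coeff p (suc i)
  coeff-derivative []      i       = sym (×-idem (+-identityʳ _) (suc i))
  coeff-derivative (a ∷ p) zero    = coeff-⊕ p (X· derivative p) 0
  coeff-derivative (a ∷ p) (suc i) =
    trans (coeff-⊕ p (X· derivative p) (suc i)) (+-congˡ (coeff-derivative p i))

  derivative-cong : ∀ {p q} → p ≋ q → derivative p ≋ derivative q
  derivative-cong {p} {q} p≋q = coeffwise λ i → trans (coeff-derivative p i)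
    (trans (×-congʳ (suc i) (at p≋q (suc i))) (sym (coeff-derivative q i)))

  derivative-⊕ : ∀ p q → derivative (p ⊕ q) ≋ derivative p ⊕ derivative q
  derivative-⊕ []      q       = P.refl
  derivative-⊕ (a ∷ p) []      = P.sym (P.+-identityʳ _)
  derivative-⊕ (a ∷ p) (b ∷ q) =
    P.trans (P.+-congˡ {p ⊕ q} (P.trans (X·-cong (derivative-⊕ p q)) (X·-⊕ (derivative p) (derivative q))))
            (interchange p q (X· derivative p) (X· derivative q))

  derivative-· : ∀ a p → derivative (a · p) ≋ a · derivative p
  derivative-· a []      = P.refl
  derivative-· a (b ∷ p) = P.trans (P.+-congˡ {a · p} (X·-cong (derivative-· a p)))
    (P.trans (P.+-congˡ {a · p} (P.sym (·-X· a (derivative p)))) (P.sym (·-⊕ a p (X· derivative p))))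

  -- Differentiating `X· (p ⊗ q)` yields an extra `p ⊗ q`, which matches the summand `p` in the
  -- derivative of `a ∷ p`.
  derivative-⊗ : ∀ p q → derivative (p ⊗ q) ≋ p ⊗ derivative q ⊕ derivative p ⊗ q
  derivative-⊗ []      q = P.refl
  derivative-⊗ (a ∷ p) q = begin
    derivative (a · q ⊕ X· (p ⊗ q))
      ≈⟨ derivative-⊕ (a · q) (X· (p ⊗ q)) ⟩
    derivative (a · q) ⊕ (p ⊗ q ⊕ X· derivative (p ⊗ q))
      ≈⟨ P.+-cong (derivative-· a q) (P.+-congˡ {p ⊗ q} (P.trans (X·-cong (derivative-⊗ p q))
           (X·-⊕ (p ⊗ derivative q) (derivative p ⊗ q)))) ⟩
    a · derivative q ⊕ (p ⊗ q ⊕ (X· (p ⊗ derivative q) ⊕ X· (derivative p ⊗ q)))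
      ≈⟨ solve 4 (λ u v w z → u :+ (v :+ (w :+ z)) := (u :+ w) :+ (v :+ z)) P.refl
           (a · derivative q) (p ⊗ q) (X· (p ⊗ derivative q)) (X· (derivative p ⊗ q)) ⟩
    (a ∷ p) ⊗ derivative q ⊕ (p ⊗ q ⊕ X· (derivative p ⊗ q))
      ≈⟨ P.+-congˡ {(a ∷ p) ⊗ derivative q} (P.+-congˡ {p ⊗ q} (X·-⊗ (derivative p) q)) ⟨
    (a ∷ p) ⊗ derivative q ⊕ (p ⊗ q ⊕ X· derivative p ⊗ q)
      ≈⟨ P.+-congˡ {(a ∷ p) ⊗ derivative q} (⊗-distribʳ q p (X· derivative p)) ⟨
    (a ∷ p) ⊗ derivative q ⊕ (p ⊕ X· derivative p) ⊗ q ∎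
    where
    open NatSolver P.commutativeSemiring using (solve; _:=_; _:+_)
    X·-⊗ : ∀ p q → X· p ⊗ q ≋ X· (p ⊗ q)
    X·-⊗ p q = P.+-congʳ (0#· q)

open Polynomial using (coeff; coeffwise; at)

-- Derivations along a ring homomorphism

module _ (A B : CommutativeRing 0ℓ 0ℓ) where

  private
    module A = CommutativeRing A
    open CommutativeRing B

  -- `B` is viewed as an `A`-module through `⟦_⟧`. The intended `δ` is a partial derivative followed
  -- by evaluation, so that values of derivatives at a point follow from the product rule alone.
  record IsDerivation (⟦_⟧ δ : A.Carrier → Carrier) : Set where
    field
      cong    : ∀ {x y} → x A.≈ y → δ x ≈ δ y
      +-homo  : ∀ x y → δ (x A.+ y) ≈ δ x + δ y
      leibniz : ∀ x y → δ (x A.* y) ≈ ⟦ x ⟧ * δ y + δ x * ⟦ y ⟧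

IsDerivation-resp : ∀ {A B ⟦_⟧ δ δ′} → (∀ x → CommutativeRing._≈_ B (δ x) (δ′ x)) →
  IsDerivation A B ⟦_⟧ δ′ → IsDerivation A B ⟦_⟧ δ
IsDerivation-resp {A} {B} {⟦_⟧} {δ} {δ′} δ≈δ′ isDerivation = record
  { cong    = λ {x} {y} x≈y → trans (δ≈δ′ x) (trans (cong x≈y) (sym (δ≈δ′ y)))
  ; +-homo  = λ x y → trans (δ≈δ′ (x A.+ y)) (trans (+-homo x y) (sym (+-cong (δ≈δ′ x) (δ≈δ′ y))))
  ; leibniz = λ x y → trans (δ≈δ′ (x A.* y)) (trans (leibniz x y)
      (sym (+-cong (*-congˡ (δ≈δ′ y)) (*-congʳ (δ≈δ′ x)))))
  }
  where
  module A = CommutativeRing A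
  open CommutativeRing B
  open IsDerivation isDerivation

-- Derivatives of s(I - Λ)(I - Λ)ᵀ at a point where Λ vanishes

module Derivation {A B : CommutativeRing 0ℓ 0ℓ} {⟦_⟧ δ : CommutativeRing.Carrier A → CommutativeRing.Carrier B}
  (isHom : RingMorphisms.IsRingHomomorphism (CommutativeRing.rawRing A) (CommutativeRing.rawRing B) ⟦_⟧)
  (isDerivation : IsDerivation A B ⟦_⟧ δ) where

  private
    module A = CommutativeRing A
    module MA = MatrixAlgebra A
    module MB = MatrixAlgebra B
  open CommutativeRing B hiding (zero)
  open RingProperties ring using (+-identityʳ-unique; +-inverseʳ-unique; -0#≈0#)
  open Sums B
  open RingMorphisms.IsRingHomomorphism isHom
    renaming (+-homo to ⟦⟧-+; *-homo to ⟦⟧-*; 0#-homo to ⟦⟧-0; 1#-homo to ⟦⟧-1; -‿homo to ⟦⟧-neg)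
  open IsDerivation isDerivation
  open import Relation.Binary.Reasoning.Setoid setoid

  ⟦⟧-sum : ∀ {n} (f : Fin n → A.Carrier) → ⟦ MA.sum f ⟧ ≈ sum (λ i → ⟦ f i ⟧)
  ⟦⟧-sum {zero}  f = ⟦⟧-0
  ⟦⟧-sum {suc n} f = trans (⟦⟧-+ (f zero) (MA.sum (f ∘ suc))) (+-congˡ (⟦⟧-sum (f ∘ suc)))

  ⟦⟧-I : ∀ {n} (i j : Fin n) → ⟦ MA.I i j ⟧ ≈ MB.I i j
  ⟦⟧-I i j with i Finₚ.≟ j
  ... | yes _ = ⟦⟧-1
  ... | no  _ = ⟦⟧-0

  δ0≈0 : δ A.0# ≈ 0#
  δ0≈0 = +-identityʳ-unique (δ A.0#) (δ A.0#) (trans (sym (+-homo A.0# A.0#)) (cong (A.+-identityˡ A.0#)))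

  δ1≈0 : δ A.1# ≈ 0#
  δ1≈0 = +-identityʳ-unique (δ A.1#) (δ A.1#) $ begin
    δ A.1# + δ A.1#                         ≈⟨ +-cong (*-identityˡ (δ A.1#)) (*-identityʳ (δ A.1#)) ⟨
    1# * δ A.1# + δ A.1# * 1#               ≈⟨ +-cong (*-congʳ ⟦⟧-1) (*-congˡ ⟦⟧-1) ⟨
    ⟦ A.1# ⟧ * δ A.1# + δ A.1# * ⟦ A.1# ⟧   ≈⟨ leibniz A.1# A.1# ⟨
    δ (A.1# A.* A.1#)                       ≈⟨ cong (A.*-identityˡ A.1#) ⟩
    δ A.1#                                  ∎

  δ-neg : ∀ x → δ (A.- x) ≈ - δ x
  δ-neg x = +-inverseʳ-unique (δ x) (δ (A.- x)) $
    trans (sym (+-homo x (A.- x))) (trans (cong (A.-‿inverseʳ x)) δ0≈0)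

  δI≈0 : ∀ {n} (i j : Fin n) → δ (MA.I i j) ≈ 0#
  δI≈0 i j with i Finₚ.≟ j
  ... | yes _ = δ1≈0
  ... | no  _ = δ0≈0

  δ-sum : ∀ {n} (f : Fin n → A.Carrier) → δ (MA.sum f) ≈ sum (λ i → δ (f i))
  δ-sum {zero}  f = δ0≈0
  δ-sum {suc n} f = trans (+-homo (f zero) (MA.sum (f ∘ suc))) (+-congˡ (δ-sum (f ∘ suc)))

  module _ {n} (Λ : Matrix A.Carrier n n) (⟦Λ⟧≈0 : ∀ i j → ⟦ Λ i j ⟧ ≈ 0#) where

    private
      M : Matrix A.Carrier n n
      M = MA.I MA.⊟ Λ

    ⟦I-Λ⟧ : ∀ i j → ⟦ M i j ⟧ ≈ MB.I i j
    ⟦I-Λ⟧ i j = begin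
      ⟦ MA.I i j A.- Λ i j ⟧        ≈⟨ ⟦⟧-+ (MA.I i j) (A.- Λ i j) ⟩
      ⟦ MA.I i j ⟧ + ⟦ A.- Λ i j ⟧  ≈⟨ +-cong (⟦⟧-I i j) (trans (⟦⟧-neg (Λ i j)) (-‿cong (⟦Λ⟧≈0 i j))) ⟩
      MB.I i j - 0#                 ≈⟨ +-congˡ -0#≈0# ⟩
      MB.I i j + 0#                 ≈⟨ +-identityʳ (MB.I i j) ⟩
      MB.I i j                      ∎

    δ[I-Λ] : ∀ i j → δ (M i j) ≈ - δ (Λ i j)
    δ[I-Λ] i j = begin
      δ (MA.I i j A.- Λ i j)           ≈⟨ +-homo (MA.I i j) (A.- Λ i j) ⟩
      δ (MA.I i j) + δ (A.- Λ i j)     ≈⟨ +-cong (δI≈0 i j) (δ-neg (Λ i j)) ⟩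
      0# - δ (Λ i j)                   ≈⟨ +-identityˡ (- δ (Λ i j)) ⟩
      - δ (Λ i j)                      ∎

    ⟦[I-Λ][I-Λ]ᵀ⟧ : ∀ i j → ⟦ (M MA.⊠ M ᵀ) i j ⟧ ≈ MB.I i j
    ⟦[I-Λ][I-Λ]ᵀ⟧ i j = begin
      ⟦ (M MA.⊠ M ᵀ) i j ⟧                ≈⟨ ⟦⟧-sum (λ k → M i k A.* M j k) ⟩
      sum (λ k → ⟦ M i k A.* M j k ⟧)
        ≈⟨ sum-cong-≋ (λ k → trans (⟦⟧-* (M i k) (M j k)) (*-cong (⟦I-Λ⟧ i k) (⟦I-Λ⟧ j k))) ⟩
      sum (λ k → MB.I i k * MB.I j k)     ≈⟨ sum-I i (MB.I j) ⟩
      MB.I j i                            ≈⟨ I-sym j i ⟩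
      MB.I i j                            ∎

    -- Both factors evaluate to the identity, so the product rule collapses to the derivative of `M`
    -- plus that of its transpose.
    δ[I-Λ][I-Λ]ᵀ : ∀ i j → δ ((M MA.⊠ M ᵀ) i j) ≈ - δ (Λ j i) - δ (Λ i j)
    δ[I-Λ][I-Λ]ᵀ i j = begin
      δ ((M MA.⊠ M ᵀ) i j)
        ≈⟨ δ-sum (λ k → M i k A.* M j k) ⟩
      sum (λ k → δ (M i k A.* M j k))
        ≈⟨ sum-cong-≋ (λ k → trans (leibniz (M i k) (M j k))
             (+-cong (*-congʳ (⟦I-Λ⟧ i k)) (trans (*-congˡ (⟦I-Λ⟧ j k)) (*-comm (δ (M i k)) (MB.I j k))))) ⟩
      sum (λ k → MB.I i k * δ (M j k) + MB.I j k * δ (M i k))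
        ≈⟨ ∑-distrib-+ (λ k → MB.I i k * δ (M j k)) (λ k → MB.I j k * δ (M i k)) ⟩
      sum (λ k → MB.I i k * δ (M j k)) + sum (λ k → MB.I j k * δ (M i k))
        ≈⟨ +-cong (sum-I i (δ ∘ M j)) (sum-I j (δ ∘ M i)) ⟩
      δ (M j i) + δ (M i j)
        ≈⟨ +-cong (δ[I-Λ] j i) (δ[I-Λ] i j) ⟩
      - δ (Λ j i) - δ (Λ i j) ∎

    δ[s[I-Λ][I-Λ]ᵀ] : ∀ s i j → δ ((s MA.• M MA.⊠ M ᵀ) i j) ≈ ⟦ s ⟧ * (- δ (Λ j i) - δ (Λ i j)) + δ s * MB.I i j
    δ[s[I-Λ][I-Λ]ᵀ] s i j = trans (leibniz s ((M MA.⊠ M ᵀ) i j))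
      (+-cong (*-congˡ (δ[I-Λ][I-Λ]ᵀ i j)) (*-congˡ (⟦[I-Λ][I-Λ]ᵀ⟧ i j)))

-- Specialisation of the variables λ to zero

private
  module R₁ = ℝ[x] 1
  module M₁ = MatrixAlgebra R₁.commutativeRing

-- Only the last variable, s, survives.
specialise : ∀ d → ℝ[x].Carrier (suc d) → R₁.Carrier
specialise zero    p = p
specialise (suc d) p = specialise d (coeff (ℝ[x].commutativeRing (suc d)) p 0)

specialise-isHomomorphism : ∀ d → RingMorphisms.IsRingHomomorphism
  (ℝ[x].rawRing (suc d)) R₁.rawRing (specialise d)
specialise-isHomomorphism zero    = record
  { isSemiringHomomorphism = record
    { isNearSemiringHomomorphism = record
      { +-isMonoidHomomorphism = record
        { isMagmaHomomorphism = record
          { isRelHomomorphism = record { cong = λ e → e }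
          ; homo = λ _ _ → R₁.refl
          }
        ; ε-homo = R₁.refl
        }
      ; *-homo = λ _ _ → R₁.refl
      }
    ; 1#-homo = R₁.refl
    }
  ; -‿homo = λ _ → R₁.refl
  }
specialise-isHomomorphism (suc d) = record
  { isSemiringHomomorphism = record
    { isNearSemiringHomomorphism = record
      { +-isMonoidHomomorphism = record
        { isMagmaHomomorphism = record
          { isRelHomomorphism = record { cong = λ e → H.⟦⟧-cong (at e 0) }
          ; homo = λ p q → R₁.trans (H.⟦⟧-cong (coeff-⊕ p q 0)) (H.+-homo (coeff R p 0) (coeff R q 0))
          }
        ; ε-homo = H.0#-homo
        }
      ; *-homo = λ p q → R₁.trans (H.⟦⟧-cong (coeff₀-⊗ p q)) (H.*-homo (coeff R p 0) (coeff R q 0))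
      }
    ; 1#-homo = H.1#-homo
    }
  ; -‿homo = λ p → R₁.trans (H.⟦⟧-cong (coeff-⊖ p 0)) (H.-‿homo (coeff R p 0))
  }
  where
  R = ℝ[x].commutativeRing (suc d)
  open Polynomial R using (coeff-⊕; coeff-⊖)
  open Polynomials ℝ[ suc d ] using (coeff₀-⊗)
  module H = RingMorphisms.IsRingHomomorphism (specialise-isHomomorphism d)

module Specialise d = RingMorphisms.IsRingHomomorphism (specialise-isHomomorphism d)

-- Once the outermost variable is set to zero, differentiating by it reads off the linear
-- coefficient, and differentiating by another variable acts on the constant term. The Leibniz rule
-- then needs only the first two coefficients of a product.
specialise-∂-isDerivation : ∀ d (r : Fin (suc d)) →
  IsDerivation (ℝ[x].commutativeRing (suc d)) R₁.commutativeRing (specialise d) (specialise d ∘ ∂ {suc d} r)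
specialise-∂-isDerivation zero zero = record
  { cong    = derivative-cong
  ; +-homo  = derivative-⊕
  ; leibniz = derivative-⊗
  }
  where
  open Derivatives (ℝ[x].commutativeRing 0)
specialise-∂-isDerivation (suc d) r = IsDerivation-resp (agree r) (isDerivation r)
  where
  R = ℝ[x].commutativeRing (suc d)
  module R = CommutativeRing R
  open Polynomial R using (coeff-⊕)
  open Polynomials ℝ[ suc d ] using (coeff₀-⊗; coeff₁-⊗)
  open Derivatives R using (coeff-derivative)
  module H = Specialise d

  δ : Fin (suc (suc d)) → ℝ[x].Carrier (suc (suc d)) → R₁.Carrier
  δ zero    p = specialise d (coeff R p 1)
  δ (suc r) p = specialise d (∂ r (coeff R p 0))

  agree : ∀ r p → specialise (suc d) (∂ r p) R₁.≈ δ r p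
  agree zero    p       = H.⟦⟧-cong (R.trans (coeff-derivative p 0) (R.+-identityʳ (coeff R p 1)))
  agree (suc r) (a ∷ p) = R₁.refl
  -- The empty list has no entry for `map (∂ r)` to act on, so its implicit constant term zero must
  -- be shown to have derivative zero.
  agree (suc r) []      = R₁.trans H.0#-homo $ R₁.sym $
    Derivation.δ0≈0 (specialise-isHomomorphism d) (specialise-∂-isDerivation d r)

  isDerivation : ∀ r → IsDerivation (ℝ[x].commutativeRing (suc (suc d))) R₁.commutativeRing (specialise (suc d)) (δ r)
  isDerivation zero    = record
    { cong    = λ e → H.⟦⟧-cong (at e 1)
    ; +-homo  = λ p q → R₁.trans (H.⟦⟧-cong (coeff-⊕ p q 1)) (H.+-homo (coeff R p 1) (coeff R q 1))
    ; leibniz = λ p q → R₁.trans (H.⟦⟧-cong (coeff₁-⊗ p q)) $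
        R₁.trans (H.+-homo (coeff R p 0 R.* coeff R q 1) (coeff R p 1 R.* coeff R q 0))
          (R₁.+-cong (H.*-homo (coeff R p 0) (coeff R q 1)) (H.*-homo (coeff R p 1) (coeff R q 0)))
    }
  isDerivation (suc r) = record
    { cong    = λ e → D.cong (at e 0)
    ; +-homo  = λ p q → R₁.trans (D.cong (coeff-⊕ p q 0)) (D.+-homo (coeff R p 0) (coeff R q 0))
    ; leibniz = λ p q → R₁.trans (D.cong (coeff₀-⊗ p q)) (D.leibniz (coeff R p 0) (coeff R q 0))
    }
    where
    module D = IsDerivation (specialise-∂-isDerivation d r)

specialise-∂var : ∀ d (r q : Fin (suc d)) → specialise d (∂ {suc d} r (var q)) R₁.≈ M₁.I r q
-- The derivative of `X` computes to `1# + 0#` followed by a trailing zero, hence the comparison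
-- coefficient by coefficient.
specialise-∂var zero    zero    zero    = coeffwise λ where
    zero          → R₀.+-identityʳ R₀.1#
    (suc zero)    → R₀.refl {R₀.0#}
    (suc (suc _)) → R₀.refl {R₀.0#}
  where
  module R₀ = ℝ[x] 0
specialise-∂var (suc d) zero    zero    = R₁.trans (H.⟦⟧-cong (ℝ[x].+-identityʳ (suc d) (ℝ[x].1# (suc d)))) H.1#-homo
  where
  module H = Specialise d
specialise-∂var (suc d) zero    (suc q) = Specialise.0#-homo d
specialise-∂var (suc d) (suc r) zero    =
  Derivation.δ0≈0 (specialise-isHomomorphism d) (specialise-∂-isDerivation d r)
specialise-∂var (suc d) (suc r) (suc q) = specialise-∂var d r q

specialise-λ : ∀ {d} (e : Fin d) → specialise d (var {suc d} (inject₁ e)) R₁.≈ R₁.0#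
specialise-λ {suc d} zero    = Specialise.0#-homo d
specialise-λ {suc d} (suc e) = specialise-λ e

specialise-s≉0 : ∀ d → ¬ specialise d (var {suc d} (fromℕ d)) R₁.≈ R₁.0#
specialise-s≉0 zero    s≈0 = ℝ[x].1≉0 0 (at s≈0 1)
specialise-s≉0 (suc d) s≈0 = specialise-s≉0 d s≈0

fullRowRank-specialise : ∀ d {m n} {M : Matrix (ℝ[x].Carrier (suc d)) m n} →
  LinearAlgebra.FullRowRank ℝ[ 1 ] (λ i j → specialise d (M i j)) → LinearAlgebra.FullRowRank ℝ[ suc d ] M
fullRowRank-specialise zero    full = full
fullRowRank-specialise (suc d) full =
  Polynomials.fullRowRank-lift ℝ[ suc d ] (fullRowRank-specialise d full)

-- Positions of edges and of matrix coordinates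

lookup-injective : ∀ {A : Set} {xs : List A} → Unique xs → ∀ i j → lookup xs i ≡ lookup xs j → i ≡ j
lookup-injective (x≢ ∷ _)      zero    zero    _  = ≡.refl
lookup-injective (x≢ ∷ _)      zero    (suc j) eq = contradiction eq (All.lookup x≢ (∈-lookup j))
lookup-injective (x≢ ∷ _)      (suc i) zero    eq = contradiction (≡.sym eq) (All.lookup x≢ (∈-lookup i))
lookup-injective (_  ∷ unique) (suc i) (suc j) eq = ≡.cong suc (lookup-injective unique i j eq)

-- Only pairs with i ≤ j index columns, while an edge may point either way; the symmetry of K later
-- absorbs the ambiguity.
pair : ∀ {n} (i j : Fin n) → ∃ λ c → lookup (pairs n) c ≡ (i , j) ⊎ lookup (pairs n) c ≡ (j , i)
pair {n} i j = [ (λ i≤j → let c , eq = ordered i≤j in c , inj₁ eq)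
               , (λ j≤i → let c , eq = ordered j≤i in c , inj₂ eq) ]′ (Finₚ.≤-total i j)
  where
  ordered : ∀ {i j} → i Fin.≤ j → ∃ λ c → lookup (pairs n) c ≡ (i , j)
  ordered {i} {j} i≤j = index i,j∈ , ≡.sym (lookup-index i,j∈)
    where
    i,j∈ : (i , j) List.∈ pairs n
    i,j∈ = ∈-filter⁺ (uncurry Finₚ._≤?_) (∈-cartesianProduct⁺ (∈-allFin i) (∈-allFin j)) i≤j

-- Collects what the Jacobian computation uses about `specialise`, so that the entries are found
-- from these laws without unfolding nested polynomials.
record Evaluation (d : ℕ) (B : IntegralDomain) : Set where
  open IntegralDomain B
  open MatrixAlgebra commutativeRing using (I)
  field
    ⟦_⟧            : ℝ[x].Carrier (suc d) → Carrier
    isHomomorphism : RingMorphisms.IsRingHomomorphism (ℝ[x].rawRing (suc d)) rawRing ⟦_⟧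
    isDerivation   : ∀ r → IsDerivation (ℝ[x].commutativeRing (suc d)) commutativeRing ⟦_⟧ (⟦_⟧ ∘ ∂ {suc d} r)
    ⟦∂var⟧         : ∀ r q → ⟦ ∂ {suc d} r (var q) ⟧ ≈ I r q
    ⟦λ⟧≈0          : ∀ e → ⟦ var {suc d} (inject₁ e) ⟧ ≈ 0#
    ⟦s⟧≉0          : ¬ ⟦ var {suc d} (fromℕ d) ⟧ ≈ 0#

specialisation : ∀ d → Evaluation d ℝ[ 1 ]
specialisation d = record
  { ⟦_⟧            = specialise d
  ; isHomomorphism = specialise-isHomomorphism d
  ; isDerivation   = specialise-∂-isDerivation d
  ; ⟦∂var⟧         = specialise-∂var d
  ; ⟦λ⟧≈0          = specialise-λ
  ; ⟦s⟧≉0          = specialise-s≉0 d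
  }

-- The Jacobian of a simple digraph at Λ = 0

module _ {n} (G : Digraph n) where

  open Digraph G

  -- The variable in `Λ` comes from whichever membership proof the decision procedure finds; as `D`
  -- has no repetition, that proof must point at position `e`.
  Λ-edge : ∀ {i j} e → lookup D e ≡ (i , j) → Λ G i j ≡ var (inject₁ e)
  Λ-edge {i} {j} e D[e]≡ with _∈D? G (i , j)
  ... | yes i,j∈D = ≡.cong (var ∘ inject₁)
    (lookup-injective unique (index i,j∈D) e (≡.trans (≡.sym (lookup-index i,j∈D)) (≡.sym D[e]≡)))
  ... | no  i,j∉D = contradiction (≡.subst (List._∈ D) D[e]≡ (∈-lookup e)) i,j∉D

  Λ-nonEdge : ∀ {i j} → ¬ (i , j) List.∈ D → Λ G i j ≡ ℝ[x].0# (suc ∣D∣)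
  Λ-nonEdge {i} {j} i,j∉D with _∈D? G (i , j)
  ... | yes i,j∈D = contradiction i,j∈D i,j∉D
  ... | no  _     = ≡.refl

  polynomialJacobian : Matrix (ℝ[x].Carrier (suc ∣D∣)) (suc ∣D∣) (length (pairs n))
  polynomialJacobian r c = ∂ {suc ∣D∣} r (uncurry (ψ G) (lookup (pairs n) c))

  module EvaluatedJacobian {B : IntegralDomain} (evaluation : Evaluation ∣D∣ B) where

    open Evaluation evaluation
    open IntegralDomain B hiding (zero)
    open MatrixAlgebra commutativeRing using (I)
    open Sums commutativeRing using (I-sym; I-diagonal; I-offDiagonal)
    open RingProperties ring using (-0#≈0#; -‿distribʳ-*; -‿involutive)
    open import Relation.Binary.Reasoning.Setoid setoid
    private
      module D r = Derivation {δ = ⟦_⟧ ∘ ∂ {suc ∣D∣} r} isHomomorphism (isDerivation r)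

    δ : Fin (suc ∣D∣) → ℝ[x].Carrier (suc ∣D∣) → Carrier
    δ r p = ⟦ ∂ {suc ∣D∣} r p ⟧

    σ : Carrier
    σ = ⟦ s G ⟧

    ⟦Λ⟧≈0 : ∀ i j → ⟦ Λ G i j ⟧ ≈ 0#
    ⟦Λ⟧≈0 i j with _∈D? G (i , j)
    ... | yes i,j∈D = ⟦λ⟧≈0 (index i,j∈D)
    ... | no  _     = RingMorphisms.IsRingHomomorphism.0#-homo isHomomorphism

    δΛ-edge : ∀ {i j} r e → lookup D e ≡ (i , j) → δ r (Λ G i j) ≈ I r (inject₁ e)
    δΛ-edge r e D[e]≡ = trans (reflexive (≡.cong (δ r) (Λ-edge e D[e]≡))) (⟦∂var⟧ r (inject₁ e))

    δΛ-nonEdge : ∀ {i j} r → ¬ (i , j) List.∈ D → δ r (Λ G i j) ≈ 0#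
    δΛ-nonEdge r i,j∉D = trans (reflexive (≡.cong (δ r) (Λ-nonEdge i,j∉D))) (D.δ0≈0 r)

    -- The derivative of K at Λ = 0: the first summand differentiates (I - Λ)(I - Λ)ᵀ, the second
    -- the factor `s`.
    δψ : Fin (suc ∣D∣) → Matrix Carrier n n
    δψ r i j = σ * (- δ r (Λ G j i) - δ r (Λ G i j)) + I r (fromℕ ∣D∣) * I i j

    δψ-correct : ∀ r i j → δ r (ψ G i j) ≈ δψ r i j
    δψ-correct r i j = trans (D.δ[s[I-Λ][I-Λ]ᵀ] r (Λ G) ⟦Λ⟧≈0 (s G) i j)
      (+-congˡ (*-congʳ (⟦∂var⟧ r (fromℕ ∣D∣))))

    δψ-sym : ∀ r i j → δψ r i j ≈ δψ r j i
    δψ-sym r i j = +-cong (*-congˡ (+-comm _ _)) (*-congˡ (I-sym i j))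

    column : ∀ i j → ∃ λ c → ∀ r → ⟦ polynomialJacobian r c ⟧ ≈ δψ r i j
    column i j with pair i j
    ... | c , inj₁ eq = c , λ r → trans (reflexive (≡.cong (δ r ∘ uncurry (ψ G)) eq)) (δψ-correct r i j)
    ... | c , inj₂ eq = c , λ r → trans (reflexive (≡.cong (δ r ∘ uncurry (ψ G)) eq))
                                    (trans (δψ-correct r j i) (δψ-sym r j i))

    -- Simplicity excludes the reverse edge, so only one of the two entries of Λ contributes; having
    -- distinct endpoints removes the contribution of `s`.
    δψ-edge : Simple G → ∀ e {i j} → lookup D e ≡ (i , j) → ∀ r → δψ r i j ≈ I (inject₁ e) r * - σ
    δψ-edge simple e {i} {j} D[e]≡ r = begin
      δψ r i j
        ≈⟨ +-cong (*-congˡ (+-cong (-‿cong (δΛ-nonEdge r λ j,i∈D → simple (i,j∈D , j,i∈D)))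
                                   (-‿cong (δΛ-edge r e D[e]≡))))
                  (*-congˡ (I-offDiagonal (loopless i,j∈D))) ⟩
      σ * (- 0# - I r (inject₁ e)) + I r (fromℕ ∣D∣) * 0#
        ≈⟨ +-cong (*-congˡ (trans (+-congʳ -0#≈0#) (+-identityˡ _))) (zeroʳ _) ⟩
      σ * - I r (inject₁ e) + 0#   ≈⟨ +-identityʳ _ ⟩
      σ * - I r (inject₁ e)        ≈⟨ -‿distribʳ-* σ (I r (inject₁ e)) ⟨
      - (σ * I r (inject₁ e))      ≈⟨ -‿cong (trans (*-comm _ _) (*-congʳ (I-sym r (inject₁ e)))) ⟩
      - (I (inject₁ e) r * σ)      ≈⟨ -‿distribʳ-* (I (inject₁ e) r) σ ⟩
      I (inject₁ e) r * - σ        ∎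
      where
      i,j∈D : (i , j) List.∈ D
      i,j∈D = ≡.subst (List._∈ D) D[e]≡ (∈-lookup e)

    -- Without loops the diagonal of Λ is zero, which leaves only the derivative of `s`.
    δψ-diagonal : ∀ i r → δψ r i i ≈ I (fromℕ ∣D∣) r * 1#
    δψ-diagonal i r = begin
      δψ r i i
        ≈⟨ +-cong (*-congˡ (+-cong -δΛ≈0 -δΛ≈0)) (*-cong (I-sym r (fromℕ ∣D∣)) (I-diagonal i)) ⟩
      σ * (0# + 0#) + I (fromℕ ∣D∣) r * 1#
        ≈⟨ +-congʳ (trans (*-congˡ (+-identityˡ 0#)) (zeroʳ σ)) ⟩
      0# + I (fromℕ ∣D∣) r * 1#
        ≈⟨ +-identityˡ _ ⟩
      I (fromℕ ∣D∣) r * 1# ∎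
      where
      -δΛ≈0 : - δ r (Λ G i i) ≈ 0#
      -δΛ≈0 = trans (-‿cong (δΛ-nonEdge r λ i,i∈D → loopless i,i∈D ≡.refl)) -0#≈0#

    fullRowRank : Fin n → Simple G → LinearAlgebra.FullRowRank B λ r c → ⟦ polynomialJacobian r c ⟧
    fullRowRank v simple = LinearAlgebra.fullRowRank-monomial B
      {M = λ r c → ⟦ polynomialJacobian r c ⟧} monomial
      where
      -σ≉0 : ¬ - σ ≈ 0#
      -σ≉0 -σ≈0 = ⟦s⟧≉0 (trans (sym (-‿involutive σ)) (trans (-‿cong -σ≈0) -0#≈0#))

      monomial : ∀ r → ∃ λ c → ∃ λ u → ¬ u ≈ 0# × ∀ r′ → ⟦ polynomialJacobian r′ c ⟧ ≈ I r r′ * u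
      monomial r with view r
      -- The last row belongs to `s` and is served by the diagonal column of `v`; every other row
      -- belongs to an edge and is served by the column of its endpoints.
      ... | ‵fromℕ = let c , entries = column v v in
        c , 1# , 1≉0 , λ r′ → trans (entries r′) (δψ-diagonal v r′)
      ... | ‵inj₁ {i = e} _ = let i , j = lookup D e ; c , entries = column i j in
        c , - σ , -σ≉0 , λ r′ → trans (entries r′) (δψ-edge simple e ≡.refl r′)

  jacobian-fullRowRank : Fin n → Simple G → LinearAlgebra.FullRowRank ℝ[ suc ∣D∣ ] polynomialJacobian
  jacobian-fullRowRank v simple = fullRowRank-specialise ∣D∣ {M = polynomialJacobian} $
    EvaluatedJacobian.fullRowRank (specialisation ∣D∣) v simple

theorem3p4 : ∀ (n : ℕ) .{{_ : NonZero n}} (G : Digraph n) → Simple G →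
    MatrixAlgebra.HasRowRank ℝ⟨ suc (Digraph.∣D∣ G) ⟩ (Jacobian G) (suc (Digraph.∣D∣ G))
    × (∀ (B : Subset (length (pairs n))) → IsBasis (JacobianMatroid G) B → ∣ B ∣ ≡ suc (Digraph.∣D∣ G))
theorem3p4 (suc n) G simple = fullRowRank⇒hasRowRank {M = Jacobian G} full , λ B → basis-size {M = Jacobian G} {B} full
  where
  open Fractions ℝ[ suc (Digraph.∣D∣ G) ] using (integralDomain; embed-fullRowRank)
  open LinearAlgebra integralDomain using (FullRowRank; fullRowRank⇒hasRowRank; basis-size)
  full : FullRowRank (Jacobian G)
  -- The vertex `zero` exists because the vertex set is nonempty; its diagonal column serves the row
  -- of `s`.
  full = embed-fullRowRank {M = polynomialJacobian G} (jacobian-fullRowRank G zero simple)
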